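{- Let $p\notin\{2,11\}$ be a prime. Assume that every $\ell\in\{0,1,\dots,N_p-1\}$ with $p\mid T(\ell)$ satisfies both $T(\ell+N_p)\not\equiv T(\ell)\pmod{p^2}$ and $\ell\equiv a\pmod{N_p}$ for some $a\in\{0,-1,-4,-17\}$. Then $\mathrm{ML}(p)$ holds.
   Context: $T$ is the Tribonacci sequence ($T(0)=0,T(1)=T(2)=1$, $T(n+3)=T(n+2)+T(n+1)+T(n)$, $n\in\mathbb Z$); $\nu_p$ is the $p$-adic valuation, $\nu_p(0)=\infty$. $N_p$ is the order of the subgroup of $(\mathcal O/p\mathcal O)^\times$ generated by the images of the roots of $X^3-X^2-X-1$, where $\mathcal O$ is the ring of integers of the splitting field of this polynomial over $\mathbb Q_p$. $\mathrm{ML}(p)$: there exists a positive integer $Q$ such that for every $i\in\{0,\dots,Q-1\}$ either (C) there is $\kappa_i\in\mathbb Z_{\ge0}$ with $\nu_p(T(n))=\kappa_i$ for all but finitely many $n\in\mathbb Z$, $n\equiv i\pmod Q$, or (L) there exist $a_i\in\mathbb Z$, $\kappa_i\in\mathbb Z$, $\mu_i\in\mathbb Z_{>0}$ with $\nu_p(a_i-i)\ge\nu_p(Q)$ and $\nu_p(T(n))=\kappa_i+\mu_i\nu_p(n-a_i)$ for all but finitely many $n\in\mathbb Z$, $n\equiv i\pmod Q$. -}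

module Defs where

open import Algebra.Apartness.Bundles using (HeytingField; HeytingCommutativeRing)
open import Algebra.Bundles using (CommutativeRing; RawRing; Group; RawGroup; AbelianGroup)
import Algebra.Definitions.RawMagma as RawMagma
import Algebra.Definitions.RawMonoid as RawMonoid
import Algebra.Morphism.Construct.Composition as Composition
import Algebra.Morphism.GroupMonomorphism as GroupMonomorphism
import Algebra.Morphism.RingMonomorphism as RingMonomorphism
open import Algebra.Morphism.Structures
  using (IsRingHomomorphism; IsRingMonomorphism; IsGroupMonomorphism)
import Algebra.Properties.CommutativeSemigroup as CommutativeSemigroupProperties
import Algebra.Properties.Ring as RingProperties
import Algebra.Properties.Semiring.Exp as Exp
import Algebra.Properties.Semiring.Sum as Sum
import Algebra.Solver.Ring.NaturalCoefficients.Default as SemiringSolver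
open import Data.Fin.Base using (Fin; zero; suc; toℕ; fromℕ<; remQuot; combine)
open import Data.Fin.Properties using (toℕ-fromℕ<; toℕ<n; remQuot-combine)
open import Data.Integer.Base as ℤ using (ℤ; +_; -[1+_])
open import Data.Integer.Divisibility.Signed as ℤ∣ using (_∣_; divides)
import Data.Integer.Properties as ℤ
import Data.Integer.Tactic.RingSolver as ℤSolver
open import Data.List.Base using (List; []; _∷_; [_]; _++_; map; foldr; length)
open import Data.List.Membership.Propositional using (_∈_; _∉_)
import Data.Maybe.Base as Maybe
open import Data.Nat.Base as ℕ using (ℕ; zero; suc; NonTrivial)
import Data.Nat.Divisibility as ℕ
open import Data.Nat.Primality using (Prime; prime⇒nonZero)
import Data.Nat.Properties as ℕ
open import Data.Product.Base using (Σ; ∃; ∃₂; _×_; _,_; proj₁; proj₂)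
open import Data.Sum.Base using (_⊎_; inj₁; inj₂)
open import Function.Base using (id; _∘_)
open import Function.Bundles using (Inverse)
open import Level using (Level; _⊔_) renaming (suc to ℓsuc)
open import Relation.Binary.PropositionalEquality as ≡
  using (_≡_; refl; cong; subst)
import Relation.Binary.Reasoning.Setoid as SetoidReasoning
open import Relation.Binary.Construct.Add.Supremum.NonStrict ℤ._≤_ using (_≤⁺_)
open import Relation.Nullary.Construct.Add.Supremum using (_⁺; ⊤⁺) renaming ([_] to fin)
open import Relation.Nullary.Decidable using (yes; no)
open import Relation.Nullary.Negation using (¬_; contradiction)
open import Relation.Unary using (Pred)

private variable
  a c k s ℓ ℓ₁ ℓ₂ ℓₐ ℓₖ : Level

T⁺ : ℕ → ℤ
T⁺ 0 = + 0
T⁺ 1 = + 1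
T⁺ 2 = + 1
T⁺ (suc (suc (suc n))) = T⁺ (suc (suc n)) ℤ.+ T⁺ (suc n) ℤ.+ T⁺ n

-- T⁻ n is the term of index - n: the recurrence solved for its lowest term.
T⁻ : ℕ → ℤ
T⁻ 0 = + 0
T⁻ 1 = + 0
T⁻ 2 = + 1
T⁻ (suc (suc (suc n))) = T⁻ n ℤ.- T⁻ (suc n) ℤ.- T⁻ (suc (suc n))

T : ℤ → ℤ
T (+ n)    = T⁺ n
T -[1+ n ] = T⁻ (suc n)

T-rec : ∀ n → T (n ℤ.+ + 3) ≡ T (n ℤ.+ + 2) ℤ.+ T (n ℤ.+ + 1) ℤ.+ T n
T-rec (+ n) rewrite ℕ.+-comm n 3 | ℕ.+-comm n 2 | ℕ.+-comm n 1 = refl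
T-rec -[1+ 0 ] = refl
T-rec -[1+ 1 ] = refl
T-rec -[1+ 2 ] = refl
T-rec -[1+ suc (suc (suc n)) ] = lemma (T⁻ (1 ℕ.+ n)) (T⁻ (2 ℕ.+ n)) (T⁻ (3 ℕ.+ n))
  where
  lemma : ∀ x y z → x ≡ y ℤ.+ z ℤ.+ (x ℤ.- y ℤ.- z)
  lemma = ℤSolver.solve-∀

-- The greatest e ≤ b such that p ^ e divides m.
maxExponent : (p m b : ℕ) → ℕ
maxExponent p m zero = 0
maxExponent p m (suc b) with p ℕ.^ suc b ℕ.∣? m
... | yes _ = suc b
... | no  _ = maxExponent p m b

-- For p ≥ 2 the bound b = |m| is large enough, as p ^ e > e (see ν-unique).
ν : ℕ → ℤ → ℤ ⁺
ν p m with ℤ.∣ m ∣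
... | zero    = ⊤⁺
... | n@(suc _) = fin (+ maxExponent p n n)

-- x ↦ κ + μ x; the value at ∞ is ∞, as it should be for μ > 0.
affine : (κ μ : ℤ) → ℤ ⁺ → ℤ ⁺
affine κ μ = Maybe.map λ x → κ ℤ.+ μ ℤ.* x

private
  ^-mono-∣ : ∀ p {m n} → m ℕ.≤ n → p ℕ.^ m ℕ.∣ p ℕ.^ n
  ^-mono-∣ p {m} {n} m≤n = ℕ.divides (p ℕ.^ (n ℕ.∸ m))
    (≡.trans (cong (p ℕ.^_) (≡.sym (ℕ.m∸n+n≡m m≤n))) (ℕ.^-distribˡ-+-* p (n ℕ.∸ m) m))

  maxExponent-unique : ∀ p .{{_ : NonTrivial p}} m e b → e ℕ.≤ b →
    p ℕ.^ e ℕ.∣ m → ¬ (p ℕ.^ suc e ℕ.∣ m) → maxExponent p m b ≡ e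
  maxExponent-unique p m zero zero e≤b d nd = refl
  maxExponent-unique p m e (suc b) e≤b d nd with p ℕ.^ suc b ℕ.∣? m | ℕ.m≤n⇒m<n∨m≡n e≤b
  ... | yes d′ | inj₁ e<sb = contradiction (ℕ.∣-trans (^-mono-∣ p e<sb) d′) nd
  ... | yes d′ | inj₂ refl = refl
  ... | no nd′ | inj₁ e<sb = maxExponent-unique p m e b (ℕ.s≤s⁻¹ e<sb) d nd
  ... | no nd′ | inj₂ refl = contradiction d nd′

  n<m^n : ∀ m .{{_ : NonTrivial m}} n → n ℕ.< m ℕ.^ n
  n<m^n m zero = ℕ.s≤s ℕ.z≤n
  n<m^n m (suc n) = ℕ.≤-trans (ℕ.+-mono-≤ (ℕ.m^n>0 m n) (n<m^n m n)) (ℕ.≤-trans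
    (ℕ.≤-reflexive (cong (m ℕ.^ n ℕ.+_) (≡.sym (ℕ.+-identityʳ _))))
    (ℕ.*-monoˡ-≤ (m ℕ.^ n) (ℕ.nonTrivial⇒n>1 m)))
    where instance _ = ℕ.nonTrivial⇒nonZero m

ν-unique : ∀ p .{{_ : NonTrivial p}} m e → + (p ℕ.^ e) ∣ m → ¬ (+ (p ℕ.^ suc e) ∣ m) →
           ν p m ≡ fin (+ e)
ν-unique p m e d nd with ℤ.∣ m ∣ in eq | ℤ∣.∣⇒∣ᵤ d
... | zero  | _ = contradiction
  (subst (+ (p ℕ.^ suc e) ∣_) (≡.sym (ℤ.∣i∣≡0⇒i≡0 eq)) (divides (+ 0) refl)) nd
... | n@(suc _) | dᵤ = cong (fin ∘ +_) (maxExponent-unique p n e n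
  (ℕ.<⇒≤ (ℕ.<-≤-trans (n<m^n p e) (ℕ.∣⇒≤ dᵤ))) dᵤ
  (λ d′ → nd (ℤ∣.∣ᵤ⇒∣ (subst (p ℕ.^ suc e ℕ.∣_) (≡.sym eq) d′))))

infix 4 _≡_[mod_]
_≡_[mod_] : ℤ → ℤ → ℕ → Set
x ≡ y [mod n ] = + n ∣ x ℤ.- y

AlmostAll : (Q : ℕ) (i : ℤ) → (ℤ → Set) → Set
AlmostAll Q i P = ∃ λ (exceptions : List ℤ) →
  ∀ n → n ≡ i [mod Q ] → n ∉ exceptions → P n

EventuallyConstant : (p Q i : ℕ) → Set
EventuallyConstant p Q i = ∃ λ (κ : ℕ) →
  AlmostAll Q (+ i) λ n → ν p (T n) ≡ fin (+ κ)

EventuallyLinear : (p Q i : ℕ) → Set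
EventuallyLinear p Q i = ∃ λ (a : ℤ) → ∃ λ (κ : ℤ) → ∃ λ (μ : ℤ) →
  + 0 ℤ.< μ ×
  ν p (+ Q) ≤⁺ ν p (a ℤ.- + i) ×
  AlmostAll Q (+ i) λ n → ν p (T n) ≡ affine κ μ (ν p (n ℤ.- a))

ML : ℕ → Set
ML p = ∃ λ (Q : ℕ) → 0 ℕ.< Q ×
  (∀ i → i ℕ.< Q → EventuallyConstant p Q i ⊎ EventuallyLinear p Q i)

-- Polynomials are coefficient lists, constant term first; trailing zeros are
-- immaterial for _≈ₚ_.
module Polynomials (R : CommutativeRing a ℓ) where
  open CommutativeRing R

  Poly : Set _
  Poly = List Carrier

  coeff : Poly → ℕ → Carrier
  coeff []      n       = 0#
  coeff (x ∷ f) zero    = x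
  coeff (x ∷ f) (suc n) = coeff f n

  infix 4 _≈ₚ_
  _≈ₚ_ : Poly → Poly → Set _
  f ≈ₚ g = ∀ n → coeff f n ≈ coeff g n

  infixl 6 _+ₚ_
  _+ₚ_ : Poly → Poly → Poly
  []      +ₚ g       = g
  (x ∷ f) +ₚ []      = x ∷ f
  (x ∷ f) +ₚ (y ∷ g) = (x + y) ∷ (f +ₚ g)

  infixl 7 _*ₚ_
  _*ₚ_ : Poly → Poly → Poly
  []      *ₚ g = []
  (x ∷ f) *ₚ g = map (x *_) g +ₚ (0# ∷ (f *ₚ g))

  X-_ : Carrier → Poly
  X- r = - r ∷ 1# ∷ []

  ∏[X-_] : List Carrier → Poly
  ∏[X- rs ] = foldr (λ r f → (X- r) *ₚ f) (1# ∷ []) rs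

  eval : Poly → Carrier → Carrier
  eval f x = foldr (λ c v → c + x * v) 0# f

  tribonacci : Poly
  tribonacci = - 1# ∷ - 1# ∷ - 1# ∷ 1# ∷ []

module _ (R : CommutativeRing a ℓ) (π : CommutativeRing.Carrier R) where
  open CommutativeRing R renaming (refl to ≈-refl)
  private
    open RawMagma *-rawMagma using (_,_) renaming (_∣_ to _∣ᴿ_)
    open RingProperties ring using (-‿distribˡ-*; -‿+-comm; ⁻¹-anti-homo-//; x[y-z]≈xy-xz; [y-z]x≈yx-zx)
    open CommutativeSemigroupProperties +-commutativeSemigroup using (interchange)

    _≈/_ : Carrier → Carrier → Set _
    x ≈/ y = π ∣ᴿ (x - y)

    ∣-resp : ∀ {x y} → x ≈ y → π ∣ᴿ x → π ∣ᴿ y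
    ∣-resp x≈y (q , e) = q , trans e x≈y

    ∣-+ : ∀ {x y} → π ∣ᴿ x → π ∣ᴿ y → π ∣ᴿ (x + y)
    ∣-+ (q , e) (q′ , e′) = (q + q′) , trans (distribʳ π q q′) (+-cong e e′)

    ∣-neg : ∀ {x} → π ∣ᴿ x → π ∣ᴿ - x
    ∣-neg (q , e) = - q , trans (sym (-‿distribˡ-* q π)) (-‿cong e)

    ∣-* : ∀ y {x} → π ∣ᴿ x → π ∣ᴿ (y * x)
    ∣-* y (q , e) = (y * q) , trans (*-assoc y q π) (*-congˡ e)

    telescope : ∀ x y z → (x - y) + (y - z) ≈ x - z
    telescope x y z = begin
      (x - y) + (y - z)     ≈⟨ +-assoc x (- y) (y - z) ⟩
      x + (- y + (y - z))   ≈⟨ +-congˡ (+-assoc (- y) y (- z)) ⟨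
      x + ((- y + y) - z)   ≈⟨ +-congˡ (+-congʳ (-‿inverseˡ y)) ⟩
      x + (0# - z)          ≈⟨ +-congˡ (+-identityˡ (- z)) ⟩
      x - z                 ∎
      where open SetoidReasoning setoid

    from-≈ : ∀ {x y} → x ≈ y → x ≈/ y
    from-≈ {x} {y} x≈y = 0# , trans (zeroˡ π) (sym (trans (+-congʳ x≈y) (-‿inverseʳ y)))

    trans/ : ∀ {x y z} → x ≈/ y → y ≈/ z → x ≈/ z
    trans/ {x} {y} {z} d e = ∣-resp (telescope x y z) (∣-+ d e)

  -- The quotient has the same carrier as R, with congruence modulo π as equality.
  _/⟨_⟩ : CommutativeRing a (a ⊔ ℓ)
  _/⟨_⟩ = record
    { Carrier = Carrier ; _≈_ = _≈/_
    ; _+_ = _+_ ; _*_ = _*_ ; -_ = -_ ; 0# = 0# ; 1# = 1#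
    ; isCommutativeRing = record
      { isRing = record
        { +-isAbelianGroup = record
          { isGroup = record
            { isMonoid = record
              { isSemigroup = record
                { isMagma = record
                  { isEquivalence = record
                    { refl  = from-≈ ≈-refl
                    ; sym   = λ {x} {y} d → ∣-resp (⁻¹-anti-homo-// x y) (∣-neg d)
                    ; trans = trans/
                    }
                  ; ∙-cong = λ {x} {y} {u} {v} d e → ∣-resp
                      (trans (interchange x (- y) u (- v)) (+-congˡ (-‿+-comm y v)))
                      (∣-+ d e)
                  }
                ; assoc = λ x y z → from-≈ (+-assoc x y z)
                }
              ; identity = (λ x → from-≈ (+-identityˡ x)) , (λ x → from-≈ (+-identityʳ x))
              }
            ; inverse = (λ x → from-≈ (-‿inverseˡ x)) , (λ x → from-≈ (-‿inverseʳ x))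
            ; ⁻¹-cong = λ {x} {y} d → ∣-resp
                (sym (-‿+-comm x (- y))) (∣-neg d)
            }
          ; comm = λ x y → from-≈ (+-comm x y)
          }
        ; *-cong = λ {x} {y} {u} {v} d e → trans/
            (∣-resp (trans (*-comm u (x - y)) ([y-z]x≈yx-zx u x y)) (∣-* u d))
            (∣-resp (x[y-z]≈xy-xz y u v) (∣-* y e))
        ; *-assoc = λ x y z → from-≈ (*-assoc x y z)
        ; *-identity = (λ x → from-≈ (*-identityˡ x)) , (λ x → from-≈ (*-identityʳ x))
        ; distrib = (λ x y z → from-≈ (distribˡ x y z)) , (λ x y z → from-≈ (distribʳ x y z))
        }
      ; *-comm = λ x y → from-≈ (*-comm x y)
      }
    }

Units : CommutativeRing a ℓ → AbelianGroup (a ⊔ ℓ) ℓ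
Units R = record
  { Carrier = ∃₂ λ x y → x * y ≈ 1#
  ; _≈_ = λ u v → proj₁ u ≈ proj₁ v
  ; _∙_ = λ (x , x⁻¹ , e) (y , y⁻¹ , e′) → x * y , x⁻¹ * y⁻¹ , mul e e′
  ; ε = 1# , 1# , *-identityˡ 1#
  ; _⁻¹ = λ (x , x⁻¹ , e) → x⁻¹ , x , trans (*-comm x⁻¹ x) e
  ; isAbelianGroup = record
    { isGroup = record
      { isMonoid = record
        { isSemigroup = record
          { isMagma = record
            { isEquivalence = record { refl = ≈-refl ; sym = sym ; trans = trans }
            ; ∙-cong = *-cong }
          ; assoc = λ (x , _) (y , _) (z , _) → *-assoc x y z }
        ; identity = (λ (x , _) → *-identityˡ x) , (λ (x , _) → *-identityʳ x) }
      ; inverse = (λ (x , x⁻¹ , e) → trans (*-comm x⁻¹ x) e) , (λ (_ , _ , e) → e)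
      ; ⁻¹-cong = λ {u} {v} → inv-cong u v }
    ; comm = λ (x , _) (y , _) → *-comm x y }
  }
  where
  open CommutativeRing R renaming (refl to ≈-refl)
  open SetoidReasoning setoid
  mul : ∀ {x x⁻¹ y y⁻¹} → x * x⁻¹ ≈ 1# → y * y⁻¹ ≈ 1# → (x * y) * (x⁻¹ * y⁻¹) ≈ 1#
  mul {x} {x⁻¹} {y} {y⁻¹} e e′ = begin
    (x * y) * (x⁻¹ * y⁻¹)   ≈⟨ solve 4 (λ x x⁻¹ y y⁻¹ → ((x ⊗ y) ⊗ (x⁻¹ ⊗ y⁻¹)) ⊜ ((x ⊗ x⁻¹) ⊗ (y ⊗ y⁻¹))) ≈-refl x x⁻¹ y y⁻¹ ⟩
    (x * x⁻¹) * (y * y⁻¹)   ≈⟨ *-cong e e′ ⟩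
    1# * 1#                 ≈⟨ *-identityˡ 1# ⟩
    1#                      ∎
    where open SemiringSolver commutativeSemiring using (solve) renaming (_:*_ to _⊗_; _:=_ to _⊜_)
  inv-cong : ∀ u v → proj₁ u ≈ proj₁ v → proj₁ (proj₂ u) ≈ proj₁ (proj₂ v)
  inv-cong (x , x⁻¹ , e) (y , y⁻¹ , e′) x≈y = begin
    x⁻¹               ≈⟨ *-identityʳ x⁻¹ ⟨
    x⁻¹ * 1#          ≈⟨ *-congˡ e′ ⟨
    x⁻¹ * (y * y⁻¹)   ≈⟨ *-assoc x⁻¹ y y⁻¹ ⟨
    (x⁻¹ * y) * y⁻¹   ≈⟨ *-congʳ (*-congˡ x≈y) ⟨
    (x⁻¹ * x) * y⁻¹   ≈⟨ *-congʳ (trans (*-comm x⁻¹ x) e) ⟩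
    1# * y⁻¹          ≈⟨ *-identityˡ y⁻¹ ⟩
    y⁻¹               ∎

module _ (G : Group a ℓ) (S : Pred (Group.Carrier G) s) where
  open Group G

  data GeneratedBy : Carrier → Set (a ⊔ s) where
    gen   : ∀ {x} → S x → GeneratedBy x
    unit  : GeneratedBy ε
    mul   : ∀ {x y} → GeneratedBy x → GeneratedBy y → GeneratedBy (x ∙ y)
    inv   : ∀ {x} → GeneratedBy x → GeneratedBy (x ⁻¹)

  generatedSubgroup : Group (a ⊔ s) ℓ
  generatedSubgroup = record { isGroup = GroupMonomorphism.isGroup isMono isGroup }
    where
    raw : RawGroup _ _
    raw = record
      { Carrier = Σ Carrier GeneratedBy
      ; _≈_ = λ x y → proj₁ x ≈ proj₁ y
      ; _∙_ = λ (x , g) (y , h) → x ∙ y , mul g h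
      ; ε   = ε , unit
      ; _⁻¹ = λ (x , g) → x ⁻¹ , inv g
      }
    isMono : IsGroupMonomorphism raw rawGroup proj₁
    isMono = record
      { isGroupHomomorphism = record
        { isMonoidHomomorphism = record
          { isMagmaHomomorphism = record
            { isRelHomomorphism = record { cong = id }
            ; homo = λ _ _ → Group.refl G }
          ; ε-homo = Group.refl G }
        ; ⁻¹-homo = λ _ → Group.refl G }
      ; injective = id
      }

HasOrder : Group a ℓ → ℕ → Set (a ⊔ ℓ)
HasOrder G n = Inverse (≡.setoid (Fin n)) (Group.setoid G)

-- The integral closure of the image of A in L.
module IntegralClosure
  (A : CommutativeRing a ℓₐ) (L : CommutativeRing c ℓ)
  {φ : CommutativeRing.Carrier A → CommutativeRing.Carrier L}
  (φ-homo : IsRingHomomorphism (CommutativeRing.rawRing A) (CommutativeRing.rawRing L) φ)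
  where

  private
    module A = CommutativeRing A
    module φ = IsRingHomomorphism φ-homo
  open CommutativeRing L hiding (zero) renaming (refl to ≈-refl)
  open Polynomials L using (eval)

  -- as ++ [ 1# ] is an arbitrary monic polynomial of degree length as.
  Integral : Carrier → Set (a ⊔ ℓ)
  Integral x = ∃ λ (as : List A.Carrier) → eval (map φ (as ++ [ A.1# ])) x ≈ 0#

  private
    open RingProperties ring using ([y-z]x≈yx-zx; xyx⁻¹≈y; -1*x≈-x; +-inverseʳ-unique)
    open Exp semiring using (_^_)
    open Sum semiring using (sum; sum-cong-≋; *-distribˡ-sum; *-distribʳ-sum; ∑-distrib-+; sum-replicate-zero)
    open SetoidReasoning setoid
    open SemiringSolver commutativeSemiring using () renaming (_:+_ to _⊕_; _:*_ to _⊗_; _:=_ to _⊜_; solve to solveL)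

    -- Low d v: v is the value at z of a polynomial of degree < d over A.
    -- Monic d v: v is the value at z of a monic polynomial of degree d.
    module At (z : Carrier) where
      data Low : ℕ → Carrier → Set (a ⊔ c ⊔ ℓ) where
        nil  : ∀ {v} → v ≈ 0# → Low 0 v
        cons : ∀ {d v w} x → Low d w → v ≈ φ x + z * w → Low (suc d) v

      data Monic : ℕ → Carrier → Set (a ⊔ c ⊔ ℓ) where
        one  : ∀ {v} → v ≈ 1# → Monic 0 v
        cons : ∀ {d v w} x → Monic d w → v ≈ φ x + z * w → Monic (suc d) v

      low-resp : ∀ {d v w} → v ≈ w → Low d v → Low d w
      low-resp e (nil e′)      = nil (trans (sym e) e′)
      low-resp e (cons x l e′) = cons x l (trans (sym e) e′)

      monic-resp : ∀ {d v w} → v ≈ w → Monic d v → Monic d w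
      monic-resp e (one e′)      = one (trans (sym e) e′)
      monic-resp e (cons x l e′) = cons x l (trans (sym e) e′)

      low-shift : ∀ {d v} → Low d v → Low (suc d) (z * v)
      low-shift l = cons A.0# l (sym (trans (+-congʳ φ.0#-homo) (+-identityˡ _)))

      monic-shift : ∀ {d v} → Monic d v → Monic (suc d) (z * v)
      monic-shift m = cons A.0# m (sym (trans (+-congʳ φ.0#-homo) (+-identityˡ _)))

      low-0 : ∀ d → Low d 0#
      low-0 zero    = nil ≈-refl
      low-0 (suc d) = low-resp (zeroʳ z) (low-shift (low-0 d))

      low-suc : ∀ {d v} → Low d v → Low (suc d) v
      low-suc (nil e)      = low-resp (sym e) (low-0 1)
      low-suc (cons x l e) = cons x (low-suc l) e

      low-weaken : ∀ n {d v} → Low d v → Low (n ℕ.+ d) v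
      low-weaken zero    l = l
      low-weaken (suc n) l = low-suc (low-weaken n l)

      add-heads : ∀ x y v w → (φ x + z * v) + (φ y + z * w) ≈ φ (x A.+ y) + z * (v + w)
      add-heads x y v w = begin
        (φ x + z * v) + (φ y + z * w)   ≈⟨ solveL 5 (λ p q z v w → ((p ⊕ (z ⊗ v)) ⊕ (q ⊕ (z ⊗ w))) ⊜ ((p ⊕ q) ⊕ (z ⊗ (v ⊕ w)))) ≈-refl (φ x) (φ y) z v w ⟩
        (φ x + φ y) + z * (v + w)       ≈⟨ +-congʳ (φ.+-homo x y) ⟨
        φ (x A.+ y) + z * (v + w)       ∎

      low-+ : ∀ {d v w} → Low d v → Low d w → Low d (v + w)
      low-+ (nil e) (nil e′) = nil (trans (+-cong e e′) (+-identityˡ 0#))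
      low-+ (cons x l e) (cons y l′ e′) =
        cons (x A.+ y) (low-+ l l′) (trans (+-cong e e′) (add-heads x y _ _))

      monic-+-low : ∀ {d v w} → Monic d v → Low d w → Monic d (v + w)
      monic-+-low (one e) (nil e′) = one (trans (+-cong e e′) (+-identityʳ 1#))
      monic-+-low (cons x l e) (cons y l′ e′) =
        cons (x A.+ y) (monic-+-low l l′) (trans (+-cong e e′) (add-heads x y _ _))

      scale-head : ∀ x y w → φ x * (φ y + z * w) ≈ φ (x A.* y) + z * (φ x * w)
      scale-head x y w = begin
        φ x * (φ y + z * w)             ≈⟨ solveL 4 (λ p q z w → (p ⊗ (q ⊕ (z ⊗ w))) ⊜ ((p ⊗ q) ⊕ (z ⊗ (p ⊗ w)))) ≈-refl (φ x) (φ y) z w ⟩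
        φ x * φ y + z * (φ x * w)       ≈⟨ +-congʳ (φ.*-homo x y) ⟨
        φ (x A.* y) + z * (φ x * w)     ∎

      low-scale : ∀ x {d v} → Low d v → Low d (φ x * v)
      low-scale x (nil e)      = nil (trans (*-congˡ e) (zeroʳ (φ x)))
      low-scale x (cons y l e) =
        cons (x A.* y) (low-scale x l) (trans (*-congˡ e) (scale-head x y _))

      φ-1 : ∀ v → φ (A.- A.1#) * v ≈ - v
      φ-1 v = begin
        φ (A.- A.1#) * v   ≈⟨ *-congʳ (φ.-‿homo A.1#) ⟩
        - φ A.1# * v       ≈⟨ *-congʳ (-‿cong φ.1#-homo) ⟩
        - 1# * v           ≈⟨ -1*x≈-x v ⟩
        - v                ∎

      low-neg : ∀ {d v} → Low d v → Low d (- v)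
      low-neg {v = v} l = low-resp (φ-1 v) (low-scale (A.- A.1#) l)

      const-low : ∀ x → Low 1 (φ x)
      const-low x = cons x (nil ≈-refl) (sym (trans (+-congˡ (zeroʳ z)) (+-identityʳ (φ x))))

      monic⇒low : ∀ {d v} → Monic d v → Low (suc d) v
      monic⇒low (one e)      = low-resp (trans φ.1#-homo (sym e)) (const-low A.1#)
      monic⇒low (cons x m e) = cons x (monic⇒low m) e

      mul-head : ∀ {v w x} u → u ≈ φ x + z * v → z * (v * w) + φ x * w ≈ u * w
      mul-head {v} {w} {x} u e = begin
        z * (v * w) + φ x * w   ≈⟨ solveL 4 (λ p z v w → ((z ⊗ (v ⊗ w)) ⊕ (p ⊗ w)) ⊜ ((p ⊕ (z ⊗ v)) ⊗ w)) ≈-refl (φ x) z v w ⟩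
        (φ x + z * v) * w       ≈⟨ *-congʳ e ⟨
        u * w                   ∎

      low-* : ∀ {d e v w} → Low d v → Low e w → Low (d ℕ.+ e) (v * w)
      low-* {e = e} {w = w} (nil v≈0) l = low-resp (sym (trans (*-congʳ v≈0) (zeroˡ w))) (low-0 e)
      low-* {suc d} (cons x l e) l′ =
        low-resp (mul-head _ e) (low-+ (low-shift (low-* l l′)) (low-weaken (suc d) (low-scale x l′)))

      monic-*-low : ∀ {d e v w} → Monic d v → Low e w → Low (d ℕ.+ e) (v * w)
      monic-*-low {w = w} (one v≈1) l = low-resp (sym (trans (*-congʳ v≈1) (*-identityˡ w))) l
      monic-*-low {suc d} (cons x m e) l =
        low-resp (mul-head _ e) (low-+ (low-shift (monic-*-low m l)) (low-weaken (suc d) (low-scale x l)))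

      monic-* : ∀ {d e v w} → Monic d v → Monic e w → Monic (d ℕ.+ e) (v * w)
      monic-* {w = w} (one v≈1) m = monic-resp (sym (trans (*-congʳ v≈1) (*-identityˡ w))) m
      monic-* {suc d} {e} {v} {w} (cons x m eq) m′ =
        monic-resp (mul-head _ eq) (monic-+-low (monic-shift (monic-* m m′))
          (subst (λ n → Low n (φ x * w)) (ℕ.+-suc d e) (low-weaken d (low-scale x (monic⇒low m′)))))

      z-monic : Monic 1 z
      z-monic = cons A.0# (one ≈-refl)
        (sym (trans (+-congʳ φ.0#-homo) (trans (+-identityˡ _) (*-identityʳ z))))

      monic⇒list : ∀ {d v} → Monic d v → ∃ λ as → eval (map φ (as ++ [ A.1# ])) z ≈ v
      monic⇒list (one e) = [] , trans (+-cong φ.1#-homo (zeroʳ z)) (trans (+-identityʳ 1#) (sym e))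
      monic⇒list (cons x m e) with monic⇒list m
      ... | as , e′ = x ∷ as , trans (+-congˡ (*-congˡ e′)) (sym e)

      -- Gaussian elimination for the system P eᵢ = Σⱼ Bᵢⱼ eⱼ yields a monic
      -- polynomial in z annihilating every eᵢ; this replaces Cayley–Hamilton.
      eliminate : ∀ n (e : Fin n → Carrier) {d P} → Monic d P →
        (B : Fin n → Fin n → Carrier) → (∀ i j → Low d (B i j)) →
        (∀ i → P * e i ≈ sum (λ j → B i j * e j)) →
        ∃₂ λ d′ Q → Monic d′ Q × (∀ i → Q * e i ≈ 0#)
      eliminate zero e mP B lB rel = 0 , 1# , one ≈-refl , λ ()
      eliminate (suc n) e {d} {P} mP B lB rel = d′ ℕ.+ d , Q′ * Q , monic-* mQ′ mQ , kills′
        where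
        Q : Carrier
        Q = P - B zero zero
        mQ : Monic d Q
        mQ = monic-+-low mP (low-neg (lB zero zero))
        S : Carrier
        S = sum (λ j → B zero (suc j) * e (suc j))
        Qe₀ : Q * e zero ≈ S
        Qe₀ = begin
          Q * e zero                                       ≈⟨ [y-z]x≈yx-zx (e zero) P (B zero zero) ⟩
          P * e zero - B zero zero * e zero                ≈⟨ +-congʳ (rel zero) ⟩
          (B zero zero * e zero + S) - B zero zero * e zero ≈⟨ xyx⁻¹≈y _ S ⟩
          S                                                ∎
        B′ : Fin n → Fin n → Carrier
        B′ i j = B (suc i) zero * B zero (suc j) + Q * B (suc i) (suc j)
        lB′ : ∀ i j → Low (d ℕ.+ d) (B′ i j)
        lB′ i j = low-+ (low-* (lB (suc i) zero) (lB zero (suc j))) (monic-*-low mQ (lB (suc i) (suc j)))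
        rel′ : ∀ i → (Q * P) * e (suc i) ≈ sum (λ j → B′ i j * e (suc j))
        rel′ i = begin
          (Q * P) * e (suc i)                ≈⟨ *-assoc Q P _ ⟩
          Q * (P * e (suc i))                ≈⟨ *-congˡ (rel (suc i)) ⟩
          Q * (β * e zero + R)               ≈⟨ solveL 4 (λ q b e r → (q ⊗ ((b ⊗ e) ⊕ r)) ⊜ ((b ⊗ (q ⊗ e)) ⊕ (q ⊗ r))) ≈-refl Q β (e zero) R ⟩
          β * (Q * e zero) + Q * R           ≈⟨ +-congʳ (*-congˡ Qe₀) ⟩
          β * S + Q * R                      ≈⟨ +-cong (*-distribˡ-sum β (λ j → B zero (suc j) * e (suc j))) (*-distribˡ-sum Q (λ j → B (suc i) (suc j) * e (suc j))) ⟩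
          sum (λ j → β * (B zero (suc j) * e (suc j))) + sum (λ j → Q * (B (suc i) (suc j) * e (suc j)))
            ≈⟨ ∑-distrib-+ (λ j → β * (B zero (suc j) * e (suc j))) _ ⟨
          sum (λ j → β * (B zero (suc j) * e (suc j)) + Q * (B (suc i) (suc j) * e (suc j)))
            ≈⟨ sum-cong-≋ (λ j → solveL 5 (λ b s e q t → ((b ⊗ (s ⊗ e)) ⊕ (q ⊗ (t ⊗ e))) ⊜ (((b ⊗ s) ⊕ (q ⊗ t)) ⊗ e)) ≈-refl β (B zero (suc j)) (e (suc j)) Q (B (suc i) (suc j))) ⟩
          sum (λ j → B′ i j * e (suc j))     ∎
          where
          β R : Carrier
          β = B (suc i) zero
          R = sum (λ j → B (suc i) (suc j) * e (suc j))
        IH : ∃₂ λ d′ Q → Monic d′ Q × (∀ i → Q * e (suc i) ≈ 0#)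
        IH = eliminate n (e ∘ suc) (monic-* mQ mP) B′ lB′ rel′
        d′ = proj₁ IH
        Q′ = proj₁ (proj₂ IH)
        mQ′ = proj₁ (proj₂ (proj₂ IH))
        kills = proj₂ (proj₂ (proj₂ IH))
        swap : ∀ x y w → x * (y * w) ≈ y * (x * w)
        swap x y w = solveL 3 (λ x y w → (x ⊗ (y ⊗ w)) ⊜ (y ⊗ (x ⊗ w))) ≈-refl x y w
        kills′ : ∀ i → (Q′ * Q) * e i ≈ 0#
        kills′ zero = begin
          (Q′ * Q) * e zero                                ≈⟨ *-assoc Q′ Q _ ⟩
          Q′ * (Q * e zero)                                ≈⟨ *-congˡ Qe₀ ⟩
          Q′ * S                                           ≈⟨ *-distribˡ-sum Q′ (λ j → B zero (suc j) * e (suc j)) ⟩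
          sum (λ j → Q′ * (B zero (suc j) * e (suc j)))    ≈⟨ sum-cong-≋ (λ j → trans (swap Q′ _ _) (trans (*-congˡ (kills j)) (zeroʳ _))) ⟩
          sum {n} (λ _ → 0#)                               ≈⟨ sum-replicate-zero n ⟩
          0#                                               ∎
        kills′ (suc i) = begin
          (Q′ * Q) * e (suc i)     ≈⟨ *-assoc Q′ Q _ ⟩
          Q′ * (Q * e (suc i))     ≈⟨ swap Q′ Q _ ⟩
          Q * (Q′ * e (suc i))     ≈⟨ *-congˡ (kills i) ⟩
          Q * 0#                   ≈⟨ zeroʳ Q ⟩
          0#                       ∎

    open At using (eliminate; z-monic; const-low; monic⇒list; φ-1)

    data Span {n} (e : Fin n → Carrier) : Carrier → Set (a ⊔ c ⊔ ℓ) where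
      resp  : ∀ {v w} → v ≈ w → Span e v → Span e w
      basis : ∀ i → Span e (e i)
      zer   : Span e 0#
      add   : ∀ {v w} → Span e v → Span e w → Span e (v + w)
      scale : ∀ x {v} → Span e v → Span e (φ x * v)

    δ : ∀ {n} → Fin n → Fin n → A.Carrier
    δ zero    zero    = A.1#
    δ zero    (suc j) = A.0#
    δ (suc i) zero    = A.0#
    δ (suc i) (suc j) = δ i j

    φ0* : ∀ v → φ A.0# * v ≈ 0#
    φ0* v = trans (*-congʳ φ.0#-homo) (zeroˡ v)

    sum-φ0 : ∀ {n} (e : Fin n → Carrier) → sum (λ j → φ A.0# * e j) ≈ 0#
    sum-φ0 {n} e = trans (sum-cong-≋ (λ j → φ0* (e j))) (sum-replicate-zero n)

    δ-sum : ∀ {n} (e : Fin n → Carrier) i → e i ≈ sum (λ j → φ (δ i j) * e j)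
    δ-sum e zero = sym (trans
      (+-cong (trans (*-congʳ φ.1#-homo) (*-identityˡ _)) (sum-φ0 (e ∘ suc))) (+-identityʳ _))
    δ-sum e (suc i) = sym (trans
      (+-cong (φ0* (e zero)) (sym (δ-sum (e ∘ suc) i))) (+-identityˡ _))

    coefficients : ∀ {n} {e : Fin n → Carrier} {v} → Span e v →
                   ∃ λ (x : Fin n → A.Carrier) → v ≈ sum (λ j → φ (x j) * e j)
    coefficients (resp e s) with x , eq ← coefficients s = x , trans (sym e) eq
    coefficients {e = e} (basis i) = δ i , δ-sum e i
    coefficients {e = e} zer = (λ _ → A.0#) , sym (sum-φ0 e)
    coefficients {e = e} (add s t) with x , eq ← coefficients s | y , eq′ ← coefficients t =
      (λ j → x j A.+ y j) , trans (+-cong eq eq′) (trans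
        (sym (∑-distrib-+ (λ j → φ (x j) * e j) _))
        (sum-cong-≋ (λ j → sym (trans (*-congʳ (φ.+-homo (x j) (y j))) (distribʳ _ _ _)))))
    coefficients {e = e} (scale r s) with x , eq ← coefficients s =
      (λ j → r A.* x j) , trans (*-congˡ eq) (trans
        (*-distribˡ-sum (φ r) (λ j → φ (x j) * e j))
        (sum-cong-≋ (λ j → sym (trans (*-congʳ (φ.*-homo r (x j))) (*-assoc _ _ _)))))

    span-neg : ∀ {n} {e : Fin n → Carrier} {v} → Span e v → Span e (- v)
    span-neg {v = v} s = resp (φ-1 0# v) (scale (A.- A.1#) s)

    span-map : ∀ {m n} {e : Fin m → Carrier} {f : Fin n → Carrier} u →
               (∀ i → Span f (u * e i)) → ∀ {v} → Span e v → Span f (u * v)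
    span-map u h (resp e s)  = resp (*-congˡ e) (span-map u h s)
    span-map u h (basis i)   = h i
    span-map u h zer         = resp (sym (zeroʳ u)) zer
    span-map u h (add s t)   = resp (sym (distribˡ u _ _)) (add (span-map u h s) (span-map u h t))
    span-map u h (scale x s) = resp (solveL 3 (λ x u v → (x ⊗ (u ⊗ v)) ⊜ (u ⊗ (x ⊗ v))) ≈-refl (φ x) u _)
                                    (scale x (span-map u h s))

    stable⇒integral : ∀ {n} {e : Fin n → Carrier} {z} i → e i ≈ 1# →
                      (∀ j → Span e (z * e j)) → Integral z
    stable⇒integral {n} {e} {z} i eᵢ≈1 stable
      with eliminate z n e (z-monic z) (λ k j → φ (proj₁ (coefficients (stable k)) j))
             (λ k j → const-low z _) (λ k → proj₂ (coefficients (stable k)))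
    ... | d , Q , mQ , kills with monic⇒list z mQ
    ... | as , eq = as , (begin
      eval (map φ (as ++ [ A.1# ])) z   ≈⟨ eq ⟩
      Q                                 ≈⟨ *-identityʳ Q ⟨
      Q * 1#                            ≈⟨ *-congˡ eᵢ≈1 ⟨
      Q * e i                           ≈⟨ kills i ⟩
      0#                                ∎)

    powers : Carrier → ∀ n → Fin n → Carrier
    powers x n i = x ^ toℕ i

    eval-snoc : ∀ as x → eval (map φ (as ++ [ A.1# ])) x ≈ eval (map φ as) x + x ^ length as
    eval-snoc [] x = trans (+-cong φ.1#-homo (zeroʳ x)) (+-comm 1# 0#)
    eval-snoc (y ∷ as) x = begin
      φ y + x * eval (map φ (as ++ [ A.1# ])) x            ≈⟨ +-congˡ (*-congˡ (eval-snoc as x)) ⟩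
      φ y + x * (eval (map φ as) x + x ^ length as)        ≈⟨ +-congˡ (distribˡ x _ _) ⟩
      φ y + (x * eval (map φ as) x + x * x ^ length as)    ≈⟨ +-assoc _ _ _ ⟨
      (φ y + x * eval (map φ as) x) + x ^ suc (length as)  ∎

    pow∈ : ∀ x {n i} → i ℕ.< n → Span (powers x n) (x ^ i)
    pow∈ x {n} {i} i<n = subst (λ k → Span (powers x n) (x ^ k)) (toℕ-fromℕ< i<n) (basis (fromℕ< i<n))

    eval∈ : ∀ x as {n} k → k ℕ.+ length as ℕ.≤ n → Span (powers x n) (x ^ k * eval (map φ as) x)
    eval∈ x [] k k≤n = resp (sym (zeroʳ _)) zer
    eval∈ x (y ∷ as) k k≤n = resp
      (solveL 4 (λ p x q e → ((p ⊗ q) ⊕ ((x ⊗ q) ⊗ e)) ⊜ (q ⊗ (p ⊕ (x ⊗ e)))) ≈-refl (φ y) x (x ^ k) _)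
      (add (scale y (pow∈ x (ℕ.≤-trans (ℕ.m≤m+n (suc k) (length as)) k+as<n))) (eval∈ x as (suc k) k+as<n))
      where k+as<n = ℕ.≤-trans (ℕ.≤-reflexive (≡.sym (ℕ.+-suc k (length as)))) k≤n

    powers-stable : ∀ x as → eval (map φ (as ++ [ A.1# ])) x ≈ 0# →
                    ∀ i → Span (powers x (length as)) (x * powers x (length as) i)
    powers-stable x as eq i with ℕ.m≤n⇒m<n∨m≡n (toℕ<n i)
    ... | inj₁ si<n = pow∈ x si<n
    ... | inj₂ si≡n = resp (begin
      - (1# * eval (map φ as) x)   ≈⟨ +-inverseʳ-unique _ _ (trans (+-congʳ (*-identityˡ _)) (trans (sym (eval-snoc as x)) eq)) ⟨
      x ^ length as                ≡⟨ cong (x ^_) si≡n ⟨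
      x * x ^ toℕ i                ∎)
      (span-neg (eval∈ x as 0 ℕ.≤-refl))

    -- The products xⁱyʲ span a module containing 1 and stable under x and y.
    module _ {x y : Carrier} (int-x : Integral x) (int-y : Integral y) where
      as bs : List A.Carrier
      as = A.0# ∷ proj₁ int-x
      bs = A.0# ∷ proj₁ int-y

      pad : ∀ {w} cs → eval (map φ (cs ++ [ A.1# ])) w ≈ 0# → eval (map φ ((A.0# ∷ cs) ++ [ A.1# ])) w ≈ 0#
      pad {w} cs eq = trans (+-cong φ.0#-homo (trans (*-congˡ eq) (zeroʳ w))) (+-identityˡ 0#)

      m n : ℕ
      m = length as
      n = length bs

      e′ : Fin m × Fin n → Carrier
      e′ (i , j) = powers x m i * powers y n j

      e : Fin (m ℕ.* n) → Carrier
      e = e′ ∘ remQuot n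

      e-combine : ∀ i j → Span e (powers x m i * powers y n j)
      e-combine i j = subst (Span e ∘ e′) (remQuot-combine i j) (basis (combine i j))

      x-stable : ∀ k → Span e (x * e k)
      x-stable k = stable (remQuot n k)
        where
        stable : ∀ ij → Span e (x * e′ ij)
        stable (i , j) = resp
          (solveL 3 (λ x p q → (q ⊗ (x ⊗ p)) ⊜ (x ⊗ (p ⊗ q))) ≈-refl x (powers x m i) (powers y n j))
          (span-map (powers y n j) (λ i′ → resp (*-comm _ _) (e-combine i′ j)) (powers-stable x as (pad (proj₁ int-x) (proj₂ int-x)) i))

      y-stable : ∀ k → Span e (y * e k)
      y-stable k = stable (remQuot n k)
        where
        stable : ∀ ij → Span e (y * e′ ij)
        stable (i , j) = resp
          (solveL 3 (λ y p q → (p ⊗ (y ⊗ q)) ⊜ (y ⊗ (p ⊗ q))) ≈-refl y (powers x m i) (powers y n j))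
          (span-map (powers x m i) (λ j′ → e-combine i j′) (powers-stable y bs (pad (proj₁ int-y) (proj₂ int-y)) j))

      e₀≈1 : e (combine {m} {n} zero zero) ≈ 1#
      e₀≈1 = trans (reflexive (cong e′ (remQuot-combine {m} {n} zero zero))) (*-identityˡ 1#)

      integral-sum : Integral (x + y)
      integral-sum = stable⇒integral (combine {m} {n} zero zero) e₀≈1
        λ k → resp (sym (distribʳ _ x y)) (add (x-stable k) (y-stable k))

      integral-product : Integral (x * y)
      integral-product = stable⇒integral (combine {m} {n} zero zero) e₀≈1
        λ k → resp (sym (*-assoc x y _)) (span-map x x-stable (y-stable k))

  integral-+ : ∀ {x y} → Integral x → Integral y → Integral (x + y)
  integral-+ = integral-sum

  integral-* : ∀ {x y} → Integral x → Integral y → Integral (x * y)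
  integral-* = integral-product

  integral-resp : ∀ {x y} → x ≈ y → Integral x → Integral y
  integral-resp {x} {y} x≈y (as , eq) = as , trans (eval-cong (map φ (as ++ [ A.1# ]))) eq
    where
    eval-cong : ∀ f → eval f y ≈ eval f x
    eval-cong []      = ≈-refl
    eval-cong (v ∷ f) = +-congˡ (*-cong (sym x≈y) (eval-cong f))

  integral-φ : ∀ x → Integral (φ x)
  integral-φ x = A.- x ∷ [] , (begin
    φ (A.- x) + φ x * (φ A.1# + φ x * 0#)   ≈⟨ +-cong (φ.-‿homo x) (*-congˡ (trans (+-cong φ.1#-homo (zeroʳ _)) (+-identityʳ 1#))) ⟩
    - φ x + φ x * 1#                        ≈⟨ +-congˡ (*-identityʳ _) ⟩
    - φ x + φ x                             ≈⟨ -‿inverseˡ _ ⟩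
    0#                                      ∎)

  integral-neg : ∀ {x} → Integral x → Integral (- x)
  integral-neg {x} int = integral-resp (φ-1 0# x) (integral-* (integral-φ (A.- A.1#)) int)

  integralClosure : CommutativeRing (a ⊔ c ⊔ ℓ) ℓ
  integralClosure = record { isCommutativeRing = RingMonomorphism.isCommutativeRing isMono isCommutativeRing }
    where
    raw : RawRing _ _
    raw = record
      { Carrier = Σ Carrier Integral
      ; _≈_ = λ x y → proj₁ x ≈ proj₁ y
      ; _+_ = λ (x , i) (y , j) → x + y , integral-+ i j
      ; _*_ = λ (x , i) (y , j) → x * y , integral-* i j
      ; -_  = λ (x , i) → - x , integral-neg i
      ; 0#  = 0# , integral-resp φ.0#-homo (integral-φ A.0#)
      ; 1#  = 1# , integral-resp φ.1#-homo (integral-φ A.1#)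
      }
    isMono : IsRingMonomorphism raw rawRing proj₁
    isMono = record
      { isRingHomomorphism = record
        { isSemiringHomomorphism = record
          { isNearSemiringHomomorphism = record
            { +-isMonoidHomomorphism = record
              { isMagmaHomomorphism = record
                { isRelHomomorphism = record { cong = id } ; homo = λ _ _ → ≈-refl }
              ; ε-homo = ≈-refl }
            ; *-homo = λ _ _ → ≈-refl }
          ; 1#-homo = ≈-refl }
        ; -‿homo = λ _ → ≈-refl }
      ; injective = id
      }

-- An element of ℤₚ = lim ℤ/pⁿ is given by integers xₙ representing its
-- components modulo pⁿ.
module _ (p : ℕ) where

  record PAdicInteger : Set where
    constructor _,_
    field
      seq      : ℕ → ℤ
      coherent : ∀ n → + (p ℕ.^ n) ∣ seq (suc n) ℤ.- seq n
  open PAdicInteger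

  private
    infix 4 _≈_
    _≈_ : PAdicInteger → PAdicInteger → Set
    x ≈ y = ∀ n → + (p ℕ.^ n) ∣ seq x n ℤ.- seq y n

    ∣-resp : ∀ {d x y} → x ≡ y → d ∣ x → d ∣ y
    ∣-resp refl d = d

    pointwise : ∀ {x y} → (∀ n → seq x n ≡ seq y n) → x ≈ y
    pointwise h n = divides (+ 0) (ℤ.i≡j⇒i-j≡0 (h n))

    sub-+ : ∀ x y u v → (x ℤ.- y) ℤ.+ (u ℤ.- v) ≡ (x ℤ.+ u) ℤ.- (y ℤ.+ v)
    sub-+ = ℤSolver.solve-∀

    sub-* : ∀ x y u v → (x ℤ.- y) ℤ.* u ℤ.+ y ℤ.* (u ℤ.- v) ≡ x ℤ.* u ℤ.- y ℤ.* v
    sub-* = ℤSolver.solve-∀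

    sub-neg : ∀ x y → ℤ.- (x ℤ.- y) ≡ (ℤ.- x) ℤ.- (ℤ.- y)
    sub-neg = ℤSolver.solve-∀

    sub-swap : ∀ x y → ℤ.- (x ℤ.- y) ≡ y ℤ.- x
    sub-swap = ℤSolver.solve-∀

    sub-trans : ∀ x y z → (x ℤ.- y) ℤ.+ (y ℤ.- z) ≡ x ℤ.- z
    sub-trans = ℤSolver.solve-∀

    mod-+ : ∀ {d} x y u v → d ∣ x ℤ.- y → d ∣ u ℤ.- v → d ∣ (x ℤ.+ u) ℤ.- (y ℤ.+ v)
    mod-+ x y u v e e′ = ∣-resp (sub-+ x y u v) (ℤ∣.∣m∣n⇒∣m+n e e′)

    mod-* : ∀ {d} x y u v → d ∣ x ℤ.- y → d ∣ u ℤ.- v → d ∣ x ℤ.* u ℤ.- y ℤ.* v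
    mod-* x y u v e e′ = ∣-resp (sub-* x y u v) (ℤ∣.∣m∣n⇒∣m+n (ℤ∣.∣m⇒∣m*n u e) (ℤ∣.∣n⇒∣m*n y e′))

    mod-neg : ∀ {d} x y → d ∣ x ℤ.- y → d ∣ (ℤ.- x) ℤ.- (ℤ.- y)
    mod-neg x y e = ∣-resp (sub-neg x y) (ℤ∣.∣m⇒∣-m e)

  fromℤ : ℤ → PAdicInteger
  fromℤ z = (λ _ → z) , λ n → divides (+ 0) (ℤ.+-inverseʳ z)

  ℤₚ : CommutativeRing _ _
  ℤₚ = record
    { Carrier = PAdicInteger
    ; _≈_ = _≈_
    ; _+_ = λ x y → (λ n → seq x n ℤ.+ seq y n) ,
        λ n → mod-+ (seq x (suc n)) (seq x n) _ _ (coherent x n) (coherent y n)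
    ; _*_ = λ x y → (λ n → seq x n ℤ.* seq y n) ,
        λ n → mod-* (seq x (suc n)) (seq x n) _ _ (coherent x n) (coherent y n)
    ; -_ = λ x → (λ n → ℤ.- seq x n) , λ n → mod-neg (seq x (suc n)) _ (coherent x n)
    ; 0# = fromℤ (+ 0)
    ; 1# = fromℤ (+ 1)
    ; isCommutativeRing = record
      { isRing = record
        { +-isAbelianGroup = record
          { isGroup = record
            { isMonoid = record
              { isSemigroup = record
                { isMagma = record
                  { isEquivalence = record
                    { refl  = λ {x} → pointwise {x} {x} (λ n → refl)
                    ; sym   = λ {x} e n → ∣-resp (sub-swap (seq x n) _) (ℤ∣.∣m⇒∣-m (e n))
                    ; trans = λ {x} {y} {z} e e′ n →
                        ∣-resp (sub-trans (seq x n) (seq y n) (seq z n)) (ℤ∣.∣m∣n⇒∣m+n (e n) (e′ n))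
                    }
                  ; ∙-cong = λ {x} {y} {u} {v} e e′ n → mod-+ (seq x n) (seq y n) (seq u n) (seq v n) (e n) (e′ n) }
                ; assoc = λ x y z → by λ n → ℤ.+-assoc (seq x n) _ _ }
              ; identity = (λ x → by λ n → ℤ.+-identityˡ (seq x n)) , (λ x → by λ n → ℤ.+-identityʳ (seq x n)) }
            ; inverse = (λ x → by λ n → ℤ.+-inverseˡ (seq x n)) , (λ x → by λ n → ℤ.+-inverseʳ (seq x n))
            ; ⁻¹-cong = λ {x} {y} e n → mod-neg (seq x n) (seq y n) (e n) }
          ; comm = λ x y → by λ n → ℤ.+-comm (seq x n) _ }
        ; *-cong = λ {x} {y} {u} {v} e e′ n → mod-* (seq x n) (seq y n) (seq u n) (seq v n) (e n) (e′ n)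
        ; *-assoc = λ x y z → by λ n → ℤ.*-assoc (seq x n) _ _
        ; *-identity = (λ x → by λ n → ℤ.*-identityˡ (seq x n)) , (λ x → by λ n → ℤ.*-identityʳ (seq x n))
        ; distrib = (λ x y z → by λ n → ℤ.*-distribˡ-+ (seq x n) _ _) , (λ x y z → by λ n → ℤ.*-distribʳ-+ (seq x n) (seq y n) (seq z n)) }
      ; *-comm = λ x y → by λ n → ℤ.*-comm (seq x n) _ }
    }
    where
    by : ∀ {f g : ℕ → ℤ} {d : ℕ → ℤ} → (∀ n → f n ≡ g n) → ∀ n → d n ∣ f n ℤ.- g n
    by h n = divides (+ 0) (ℤ.i≡j⇒i-j≡0 (h n))

Cancellable : (R : CommutativeRing a ℓ) → CommutativeRing.Carrier R → Set (a ⊔ ℓ)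
Cancellable R π = ∀ x y → π * x ≈ π * y → x ≈ y
  where open CommutativeRing R

-- R[1/π] for a cancellable π; the pair (x , m) stands for x / πᵐ.
module Away (R : CommutativeRing a ℓ) (π : CommutativeRing.Carrier R) (cancel : Cancellable R π) where
  open CommutativeRing R hiding (zero) renaming (refl to ≈-refl)

  private
    open RingProperties ring using (-‿distribˡ-*)
    open Exp semiring using (_^_; ^-homo-*)
    open SetoidReasoning setoid
    open SemiringSolver commutativeSemiring using () renaming (_:+_ to _⊕_; _:*_ to _⊗_; _:=_ to _⊜_; solve to solveR)

    infix 4 _≈π_
    _≈π_ : Carrier × ℕ → Carrier × ℕ → Set _
    (x , m) ≈π (y , n) = x * π ^ n ≈ y * π ^ m

    cancel^ : ∀ n {x y} → x * π ^ n ≈ y * π ^ n → x ≈ y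
    cancel^ zero    e = trans (sym (*-identityʳ _)) (trans e (*-identityʳ _))
    cancel^ (suc n) {x} {y} e = cancel^ n (cancel _ _ (trans (shuffle x) (trans e (sym (shuffle y)))))
      where
      shuffle : ∀ x → π * (x * π ^ n) ≈ x * (π * π ^ n)
      shuffle x = solveR 3 (λ p x q → (p ⊗ (x ⊗ q)) ⊜ (x ⊗ (p ⊗ q))) ≈-refl π x (π ^ n)

    _+π_ _*π_ : Carrier × ℕ → Carrier × ℕ → Carrier × ℕ
    (x , m) +π (y , n) = (x * π ^ n + y * π ^ m) , m ℕ.+ n
    (x , m) *π (y , n) = (x * y) , m ℕ.+ n

    -π_ : Carrier × ℕ → Carrier × ℕ
    -π (x , m) = - x , m

    trans-π : ∀ x y z → x ≈π y → y ≈π z → x ≈π z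
    trans-π (x , m) (y , n) (z , k) e e′ = cancel^ n (begin
      (x * π ^ k) * π ^ n   ≈⟨ swap x (π ^ k) (π ^ n) ⟩
      (x * π ^ n) * π ^ k   ≈⟨ *-congʳ e ⟩
      (y * π ^ m) * π ^ k   ≈⟨ swap y (π ^ m) (π ^ k) ⟩
      (y * π ^ k) * π ^ m   ≈⟨ *-congʳ e′ ⟩
      (z * π ^ n) * π ^ m   ≈⟨ swap z (π ^ n) (π ^ m) ⟩
      (z * π ^ m) * π ^ n   ∎)
      where
      swap : ∀ x u v → (x * u) * v ≈ (x * v) * u
      swap x u v = solveR 3 (λ x u v → ((x ⊗ u) ⊗ v) ⊜ ((x ⊗ v) ⊗ u)) ≈-refl x u v

    same : ∀ {x y} m n → m ≡ n → x ≈ y → (x , m) ≈π (y , n)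
    same m .m refl e = *-congʳ e

    ^-+ : ∀ m n → π ^ (m ℕ.+ n) ≈ π ^ m * π ^ n
    ^-+ = ^-homo-* π

    +-cong-π : ∀ x y u v → x ≈π y → u ≈π v → (x +π u) ≈π (y +π v)
    +-cong-π (x , m) (y , n) (u , k) (v , l) e e′ = begin
      (x * π ^ k + u * π ^ m) * π ^ (n ℕ.+ l)         ≈⟨ *-congˡ (^-+ n l) ⟩
      (x * π ^ k + u * π ^ m) * (π ^ n * π ^ l)       ≈⟨ regroup x u (π ^ k) (π ^ m) (π ^ n) (π ^ l) ⟩
      (x * π ^ n) * (π ^ k * π ^ l) + (u * π ^ l) * (π ^ m * π ^ n)
        ≈⟨ +-cong (*-congʳ e) (*-congʳ e′) ⟩
      (y * π ^ m) * (π ^ k * π ^ l) + (v * π ^ k) * (π ^ m * π ^ n)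
        ≈⟨ regroup′ y v (π ^ l) (π ^ n) (π ^ m) (π ^ k) ⟩
      (y * π ^ l + v * π ^ n) * (π ^ m * π ^ k)       ≈⟨ *-congˡ (^-+ m k) ⟨
      (y * π ^ l + v * π ^ n) * π ^ (m ℕ.+ k)         ∎
      where
      regroup : ∀ x u k m n l → (x * k + u * m) * (n * l) ≈ (x * n) * (k * l) + (u * l) * (m * n)
      regroup x u k m n l = solveR 6 (λ x u k m n l → (((x ⊗ k) ⊕ (u ⊗ m)) ⊗ (n ⊗ l)) ⊜ (((x ⊗ n) ⊗ (k ⊗ l)) ⊕ ((u ⊗ l) ⊗ (m ⊗ n)))) ≈-refl x u k m n l
      regroup′ : ∀ y v l n m k → (y * m) * (k * l) + (v * k) * (m * n) ≈ (y * l + v * n) * (m * k)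
      regroup′ y v l n m k = solveR 6 (λ y v l n m k → (((y ⊗ m) ⊗ (k ⊗ l)) ⊕ ((v ⊗ k) ⊗ (m ⊗ n))) ⊜ (((y ⊗ l) ⊕ (v ⊗ n)) ⊗ (m ⊗ k))) ≈-refl y v l n m k

    *-cong-π : ∀ x y u v → x ≈π y → u ≈π v → (x *π u) ≈π (y *π v)
    *-cong-π (x , m) (y , n) (u , k) (v , l) e e′ = begin
      (x * u) * π ^ (n ℕ.+ l)           ≈⟨ *-congˡ (^-+ n l) ⟩
      (x * u) * (π ^ n * π ^ l)         ≈⟨ swap x u (π ^ n) (π ^ l) ⟩
      (x * π ^ n) * (u * π ^ l)         ≈⟨ *-cong e e′ ⟩
      (y * π ^ m) * (v * π ^ k)         ≈⟨ swap y v (π ^ m) (π ^ k) ⟨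
      (y * v) * (π ^ m * π ^ k)         ≈⟨ *-congˡ (^-+ m k) ⟨
      (y * v) * π ^ (m ℕ.+ k)           ∎
      where
      swap : ∀ x u n l → (x * u) * (n * l) ≈ (x * n) * (u * l)
      swap x u n l = solveR 4 (λ x u n l → ((x ⊗ u) ⊗ (n ⊗ l)) ⊜ ((x ⊗ n) ⊗ (u ⊗ l))) ≈-refl x u n l

    +-assoc-π : ∀ x y z → ((x +π y) +π z) ≈π (x +π (y +π z))
    +-assoc-π (x , m) (y , n) (z , k) = same _ _ (ℕ.+-assoc m n k) (begin
      (x * π ^ n + y * π ^ m) * π ^ k + z * π ^ (m ℕ.+ n)    ≈⟨ +-congˡ (*-congˡ (^-+ m n)) ⟩
      (x * π ^ n + y * π ^ m) * π ^ k + z * (π ^ m * π ^ n)  ≈⟨ solveR 6 (λ x y z m n k → ((((x ⊗ n) ⊕ (y ⊗ m)) ⊗ k) ⊕ (z ⊗ (m ⊗ n))) ⊜ ((x ⊗ (n ⊗ k)) ⊕ (((y ⊗ k) ⊕ (z ⊗ n)) ⊗ m))) ≈-refl x y z (π ^ m) (π ^ n) (π ^ k) ⟩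
      x * (π ^ n * π ^ k) + (y * π ^ k + z * π ^ n) * π ^ m  ≈⟨ +-congʳ (*-congˡ (^-+ n k)) ⟨
      x * π ^ (n ℕ.+ k) + (y * π ^ k + z * π ^ n) * π ^ m    ∎)

    +-comm-π : ∀ x y → (x +π y) ≈π (y +π x)
    +-comm-π (x , m) (y , n) = same _ _ (ℕ.+-comm m n) (+-comm _ _)

    +-identityˡ-π : ∀ x → ((0# , 0) +π x) ≈π x
    +-identityˡ-π (x , m) = same m m refl
      (trans (+-cong (zeroˡ _) (*-identityʳ x)) (+-identityˡ x))

    -‿inverseˡ-π : ∀ x → ((-π x) +π x) ≈π (0# , 0)
    -‿inverseˡ-π (x , m) = begin
      (- x * π ^ m + x * π ^ m) * π ^ 0   ≈⟨ *-identityʳ _ ⟩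
      - x * π ^ m + x * π ^ m             ≈⟨ distribʳ _ _ _ ⟨
      (- x + x) * π ^ m                   ≈⟨ *-congʳ (-‿inverseˡ x) ⟩
      0# * π ^ m                          ≈⟨ zeroˡ _ ⟩
      0#                                  ≈⟨ zeroˡ _ ⟨
      0# * π ^ (m ℕ.+ m)                  ∎

    distribˡ-π : ∀ x y z → (x *π (y +π z)) ≈π ((x *π y) +π (x *π z))
    distribˡ-π (x , m) (y , n) (z , k) = begin
      (x * (y * π ^ k + z * π ^ n)) * π ^ ((m ℕ.+ n) ℕ.+ (m ℕ.+ k))
        ≈⟨ *-congˡ (trans (^-+ (m ℕ.+ n) (m ℕ.+ k)) (*-cong (^-+ m n) (^-+ m k))) ⟩
      (x * (y * π ^ k + z * π ^ n)) * ((π ^ m * π ^ n) * (π ^ m * π ^ k))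
        ≈⟨ solveR 6 (λ x y z m n k → ((x ⊗ ((y ⊗ k) ⊕ (z ⊗ n))) ⊗ ((m ⊗ n) ⊗ (m ⊗ k))) ⊜ ((((x ⊗ y) ⊗ (m ⊗ k)) ⊕ ((x ⊗ z) ⊗ (m ⊗ n))) ⊗ (m ⊗ (n ⊗ k)))) ≈-refl x y z (π ^ m) (π ^ n) (π ^ k) ⟩
      ((x * y) * (π ^ m * π ^ k) + (x * z) * (π ^ m * π ^ n)) * (π ^ m * (π ^ n * π ^ k))
        ≈⟨ *-cong (+-cong (*-congˡ (^-+ m k)) (*-congˡ (^-+ m n))) (trans (^-+ m (n ℕ.+ k)) (*-congˡ (^-+ n k))) ⟨
      ((x * y) * π ^ (m ℕ.+ k) + (x * z) * π ^ (m ℕ.+ n)) * π ^ (m ℕ.+ (n ℕ.+ k))  ∎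

  localization : CommutativeRing a ℓ
  localization = record
    { Carrier = Carrier × ℕ ; _≈_ = _≈π_
    ; _+_ = _+π_ ; _*_ = _*π_ ; -_ = -π_ ; 0# = 0# , 0 ; 1# = 1# , 0
    ; isCommutativeRing = record
      { isRing = record
        { +-isAbelianGroup = record
          { isGroup = record
            { isMonoid = record
              { isSemigroup = record
                { isMagma = record
                  { isEquivalence = record
                    { refl = ≈-refl ; sym = sym ; trans = λ {x} {y} {z} → trans-π x y z }
                  ; ∙-cong = λ {x} {y} {u} {v} → +-cong-π x y u v }
                ; assoc = +-assoc-π }
              ; identity = +-identityˡ-π , λ x → trans-π (x +π (0# , 0)) ((0# , 0) +π x) x (+-comm-π x (0# , 0)) (+-identityˡ-π x) }
            ; inverse = -‿inverseˡ-π , λ x → trans-π (x +π (-π x)) ((-π x) +π x) (0# , 0) (+-comm-π x (-π x)) (-‿inverseˡ-π x)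
            ; ⁻¹-cong = λ {x} {y} e → trans (sym (-‿distribˡ-* _ _)) (trans (-‿cong e) (-‿distribˡ-* _ _)) }
          ; comm = +-comm-π }
        ; *-cong = λ {x} {y} {u} {v} → *-cong-π x y u v
        ; *-assoc = λ (x , m) (y , n) (z , k) → same _ _ (ℕ.+-assoc m n k) (*-assoc x y z)
        ; *-identity = *-identityˡ-π , λ x → trans-π (x *π (1# , 0)) ((1# , 0) *π x) x (*-comm-π x (1# , 0)) (*-identityˡ-π x)
        ; distrib = distribˡ-π , λ x y z → trans-π ((y +π z) *π x) (x *π (y +π z)) ((y *π x) +π (z *π x)) (*-comm-π (y +π z) x)
            (trans-π (x *π (y +π z)) ((x *π y) +π (x *π z)) ((y *π x) +π (z *π x)) (distribˡ-π x y z)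
              (+-cong-π (x *π y) (y *π x) (x *π z) (z *π x) (*-comm-π x y) (*-comm-π x z))) }
      ; *-comm = *-comm-π }
    }
    where
    *-comm-π : ∀ x y → (x *π y) ≈π (y *π x)
    *-comm-π (x , m) (y , n) = same _ _ (ℕ.+-comm m n) (*-comm x y)
    *-identityˡ-π : ∀ x → ((1# , 0) *π x) ≈π x
    *-identityˡ-π (x , m) = same m m refl (*-identityˡ x)

  embed : Carrier → Carrier × ℕ
  embed x = x , 0

  embed-homo : IsRingHomomorphism rawRing (CommutativeRing.rawRing localization) embed
  embed-homo = record
    { isSemiringHomomorphism = record
      { isNearSemiringHomomorphism = record
        { +-isMonoidHomomorphism = record
          { isMagmaHomomorphism = record
            { isRelHomomorphism = record { cong = *-congʳ }
            ; homo = λ x y → *-congʳ (+-cong (sym (*-identityʳ x)) (sym (*-identityʳ y))) }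
          ; ε-homo = ≈-refl }
        ; *-homo = λ _ _ → ≈-refl }
      ; 1#-homo = ≈-refl }
    ; -‿homo = λ _ → ≈-refl }

module PAdic (p : ℕ) (p-prime : Prime p) where
  private
    instance _ = prime⇒nonZero p-prime
    open PAdicInteger

    factor : ∀ p x y → p ℤ.* x ℤ.- p ℤ.* y ≡ p ℤ.* (x ℤ.- y)
    factor = ℤSolver.solve-∀

    descend : ∀ x y x′ y′ → (x′ ℤ.- y′) ℤ.+ ((y′ ℤ.- y) ℤ.- (x′ ℤ.- x)) ≡ x ℤ.- y
    descend = ℤSolver.solve-∀

  p-cancel : Cancellable (ℤₚ p) (fromℤ p (+ p))
  p-cancel x y e n = subst (+ (p ℕ.^ n) ∣_) (descend (seq x n) (seq y n) (seq x (suc n)) (seq y (suc n)))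
    (ℤ∣.∣m∣n⇒∣m+n
      (ℤ∣.*-cancelˡ-∣ (+ p) (≡.subst₂ _∣_ (ℤ.pos-* p (p ℕ.^ n)) (factor (+ p) (seq x (suc n)) (seq y (suc n))) (e (suc n))))
      (ℤ∣.∣m∣n⇒∣m-n (coherent y n) (coherent x n)))

  open Away (ℤₚ p) (fromℤ p (+ p)) p-cancel public
    renaming (localization to ℚₚ; embed to ℤₚ→ℚₚ; embed-homo to ℤₚ→ℚₚ-homo)

fieldRing : HeytingField c ℓ₁ ℓ₂ → CommutativeRing c ℓ₁
fieldRing L = HeytingCommutativeRing.commutativeRing (HeytingField.heytingCommutativeRing L)

module _ {K : CommutativeRing k ℓₖ} {L : CommutativeRing c ℓ}
         (ι : CommutativeRing.Carrier K → CommutativeRing.Carrier L)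
         (S : Pred (CommutativeRing.Carrier L) s) where
  open CommutativeRing L

  data Adjoin : Carrier → Set (k ⊔ c ⊔ ℓ ⊔ s) where
    resp : ∀ {x y} → x ≈ y → Adjoin x → Adjoin y
    base : ∀ x → Adjoin (ι x)
    gen  : ∀ {x} → S x → Adjoin x
    add  : ∀ {x y} → Adjoin x → Adjoin y → Adjoin (x + y)
    neg  : ∀ {x} → Adjoin x → Adjoin (- x)
    mul  : ∀ {x y} → Adjoin x → Adjoin y → Adjoin (x * y)
    inv  : ∀ {x y} → Adjoin x → x * y ≈ 1# → Adjoin y

-- f has to be monic: splits has no leading coefficient.  The base field enters
-- only through its ring structure, and L being a field is expressed
-- constructively, with invertibility equivalent to being apart from 0#.
record SplittingField (K : CommutativeRing k ℓₖ) (f : List (CommutativeRing.Carrier K)) c ℓ₁ ℓ₂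
       : Set (k ⊔ ℓₖ ⊔ ℓsuc (c ⊔ ℓ₁ ⊔ ℓ₂)) where
  field
    L : HeytingField c ℓ₁ ℓ₂
  ring = fieldRing L
  open CommutativeRing ring using (Carrier; rawRing; _≈_; 0#) public
  open Polynomials ring
  field
    ι         : CommutativeRing.Carrier K → Carrier
    ι-mono    : IsRingMonomorphism (CommutativeRing.rawRing K) rawRing ι
    roots     : List Carrier
    splits    : map ι f ≈ₚ ∏[X- roots ]
    generated : ∀ x → Adjoin {K = K} {L = ring} ι (_∈ roots) x

  IsRoot : Carrier → Set ℓ₁
  IsRoot x = eval (map ι f) x ≈ 0#

module _ (p : ℕ) (p-prime : Prime p) where
  open PAdic p p-prime

  TribonacciField : ∀ c ℓ₁ ℓ₂ → Set _
  TribonacciField = SplittingField ℚₚ (Polynomials.tribonacci ℚₚ)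

  module _ (F : TribonacciField c ℓ₁ ℓ₂) where
    open SplittingField F

    -- The ring of integers of a finite extension of ℚₚ is the integral closure
    -- of ℤₚ in it.
    𝒪 : CommutativeRing _ _
    𝒪 = IntegralClosure.integralClosure (ℤₚ p) ring
      (Composition.isRingHomomorphism (CommutativeRing.trans ring)
        ℤₚ→ℚₚ-homo (IsRingMonomorphism.isRingHomomorphism ι-mono))

    𝒪/p : CommutativeRing _ _
    𝒪/p = 𝒪 /⟨ p · 1# ⟩
      where
      open CommutativeRing 𝒪 using (1#; +-rawMonoid)
      open RawMonoid +-rawMonoid renaming (_×_ to _·_)

    IsImageOfRoot : Pred (AbelianGroup.Carrier (Units 𝒪/p)) _
    IsImageOfRoot (u , _) = ∃ λ ((x , x∈𝒪) : CommutativeRing.Carrier 𝒪) →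
      IsRoot x × CommutativeRing._≈_ 𝒪/p u (x , x∈𝒪)

    rootGroup : Group _ _
    rootGroup = generatedSubgroup (AbelianGroup.group (Units 𝒪/p)) IsImageOfRoot

{-# OPTIONS --safe #-}
-- Let x, y, z be the roots of X³ - X² - X - 1 and S n = xⁿ + yⁿ + zⁿ.  Lagrange's
-- theorem gives xᴺ ≡ 1 modulo p𝒪, and likewise for y and z, so N is a period of S
-- modulo p.  The discriminant -44 is prime to p, hence 22 s is an integral
-- combination of S and its shifts for every integral Tribonacci sequence s, and
-- N is a period modulo p of every s.  Writing E for the shift by N, E ^ pᵏ - 1 is
-- therefore divisible by pᵏ⁺¹ and congruent to pᵏ (E - 1) modulo pᵏ⁺² (p is odd).
-- If T a = 0, this yields ν (T (a + N m)) = 1 + ν m as soon as T (a + N) is not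
-- divisible by p²: one may take Q = N without any exceptions.
module Submission where

open import Defs
open import Algebra.Bundles using (AbelianGroup; CommutativeMonoid; CommutativeRing; Group)
import Algebra.Definitions.RawMagma as RawMagma
import Algebra.Definitions.RawMonoid as RawMonoid
import Algebra.Morphism.Construct.Composition as Composition
open import Algebra.Morphism.Structures using (IsRingHomomorphism; IsRingMonomorphism)
import Algebra.Properties.CommutativeMonoid.Sum as Sum
import Algebra.Properties.CommutativeSemigroup as CommutativeSemigroupProperties
import Algebra.Properties.Group as GroupProperties
import Algebra.Properties.Ring as RingProperties
import Algebra.Properties.Semiring.Exp as Exp
import Algebra.Solver.Ring.NaturalCoefficients.Default as SemiringSolver
open import Data.Fin using (Fin)
open import Data.Fin.Permutation using (Permutation; permutation)
open import Data.Integer using (ℤ; +_; -[1+_])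
import Data.Integer.Base as ℤ
import Data.Integer.Properties as ℤ
open import Data.Integer.Divisibility.Signed as ℤ∣ using (_∣_; divides)
open import Data.Integer.Tactic.RingSolver using (solve-∀)
open import Data.List using (List; []; _∷_; _++_; [_]; length; map)
open import Data.List.Membership.Propositional using (_∈_)
open import Data.List.Relation.Unary.Any using (here; there)
open import Data.Nat using (ℕ; zero; suc; _<_; z≤n; s≤s)
import Data.Nat.Base as ℕ
import Data.Nat.Divisibility as ℕ
open import Data.Nat.Induction using (<-rec)
open import Data.Nat.Primality
  using (Prime; prime?; ¬prime[1]; prime⇒irreducible; prime⇒nonZero; prime⇒nonTrivial; euclidsLemma)
import Data.Nat.Properties as ℕ
import Data.Nat.Tactic.RingSolver as ℕSolver
open import Data.Product using (_×_; _,_; ∃-syntax; proj₁; proj₂)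
open import Data.Sum using (_⊎_; inj₁; inj₂)
open import Function using (_∘_)
open import Function.Bundles using (Inverse)
open import Level using (Level)
open import Relation.Binary using (tri<; tri≈; tri>)
open import Relation.Binary.Construct.Add.Supremum.NonStrict ℤ._≤_ using (_≤⁺_; _≤⊤⁺) renaming ([_] to fin≤)
import Relation.Binary.PropositionalEquality as ≡
open ≡ using (_≡_; _≢_)
import Relation.Binary.Reasoning.Setoid as SetoidReasoning
open import Relation.Nullary using (¬_; contradiction; Dec; yes; no; from-yes)
open import Relation.Nullary.Construct.Add.Supremum using () renaming ([_] to fin)

-- Two passages carry the proof. The first leads from 𝒪 to ℤ: powers of roots are congruent modulo
-- p𝒪, and p𝒪 ∩ ℤ = pℤ is what turns this into congruences of integers. If s = p z with z integral
-- of degree d, then pᵈ times the equation of z reads sᵈ + (multiples of p) = 0, so p divides s. The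
-- second leads from p to its powers. The period has to hold for all integral Tribonacci sequences
-- at once, because Δ s / p (with Δ = E - 1) is again one of them: the period applies to it in turn,
-- whence p² divides Δ² s and p³ divides Δ³ s. As p also divides p(p - 1)/2, everything beyond first
-- order in (1 + Δ)ᵖ is negligible. The discriminant enters as the determinant of the Hankel matrix
-- of S, which is a Vandermonde matrix times its transpose; the adjugate happens to be even, hence
-- 22 in place of 44. The zeros must be genuine ones: at a mere zero modulo p the expansion would
-- keep the constant term T a.

private variable
  c ℓ : Level

-- Lagrange's theorem for abelian groups

module _ (G : Group c ℓ) (comm : ∀ x y → Group._≈_ G (Group._∙_ G x y) (Group._∙_ G y x)) where
  open Group G
  open RawMonoid rawMonoid using () renaming (_×_ to _·_)

  -- Multiplication by g permutes the group, so the product of all elements is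
  -- unchanged when multiplied by n · g.
  lagrange : ∀ {n} → HasOrder G n → ∀ g → n · g ≈ ε
  lagrange {n} order g = GroupProperties.identityˡ-unique G (n · g) (sum to) (begin
    (n · g) ∙ sum to                  ≈⟨ ∙-congʳ (sum-replicate n) ⟨
    sum {n} (λ _ → g) ∙ sum to        ≈⟨ ∑-distrib-+ (λ _ → g) to ⟨
    sum (λ i → g ∙ to i)              ≈⟨ sum-cong-≋ {n} {λ i → to (from (g ∙ to i))} {λ i → g ∙ to i} (λ i → to-from ≡.refl) ⟨
    sum (λ i → to (from (g ∙ to i)))  ≈⟨ sum-permute to translation ⟨
    sum to                            ∎)
    where
    open Inverse order using (to; from) renaming (inverseˡ to to-from; inverseʳ to from-to)
    commutativeMonoid : CommutativeMonoid _ _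
    commutativeMonoid = record { isCommutativeMonoid = record { isMonoid = isMonoid ; comm = comm } }
    open Sum commutativeMonoid
      using (sum; sum-replicate; ∑-distrib-+; sum-cong-≋; sum-permute)
    open SetoidReasoning setoid
    translate : Carrier → Fin n → Fin n
    translate x i = from (x ∙ to i)
    undo : ∀ {x y} → x ∙ y ≈ ε → ∀ i → translate x (translate y i) ≡ i
    undo {x} {y} xy≈ε i = from-to (begin
      x ∙ to (from (y ∙ to i))   ≈⟨ ∙-congˡ (to-from ≡.refl) ⟩
      x ∙ (y ∙ to i)             ≈⟨ assoc x y (to i) ⟨
      (x ∙ y) ∙ to i             ≈⟨ ∙-congʳ xy≈ε ⟩
      ε ∙ to i                   ≈⟨ identityˡ (to i) ⟩
      to i                       ∎)
    translation : Permutation n n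
    translation = permutation (translate g) (translate (g ⁻¹)) (undo (inverseʳ g)) (undo (inverseˡ g))

  module _ {c′ ℓ′} (L : CommutativeRing c′ ℓ′) (f : Carrier → CommutativeRing.Carrier L) where
    private module L = CommutativeRing L
    open Exp L.semiring using () renaming (_^_ to _^ᴸ_)

    power-image : f ε L.≈ L.1# → (∀ x y → f (x ∙ y) L.≈ f x L.* f y) → ∀ n g → f (n · g) L.≈ f g ^ᴸ n
    power-image f-ε f-∙ zero    g = f-ε
    power-image f-ε f-∙ (suc n) g = L.trans (f-∙ g (n · g)) (L.*-congˡ (power-image f-ε f-∙ n g))

    -- The predicate Q keeps n · g out of the type: for G = rootGroup that element
    -- carries integrality proofs whose normal forms are intractable.
    lagrange-image : f ε L.≈ L.1# → (∀ x y → f (x ∙ y) L.≈ f x L.* f y) →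
      ∀ {q} (Q : L.Carrier → Set q) → (∀ {u v} → u L.≈ v → Q u → Q v) →
      (∀ x → x ≈ ε → Q (f x)) → ∀ {n} → HasOrder G n → ∀ g → Q (f g ^ᴸ n)
    lagrange-image f-ε f-∙ Q Q-resp Q-ε {n} order g =
      Q-resp (power-image f-ε f-∙ n g) (Q-ε (n · g) (lagrange order g))

-- Polynomials with given roots

module _ (R : CommutativeRing c ℓ) where
  open CommutativeRing R renaming (refl to ≈-refl)
  open Polynomials R
  open RingProperties ring using (-‿distribˡ-*; -‿distribʳ-*; -‿involutive; -‿+-comm; x[y-z]≈xy-xz)
  open CommutativeSemigroupProperties +-commutativeSemigroup using (interchange)
  open SetoidReasoning setoid
  open SemiringSolver commutativeSemiring using (solve; con) renaming (_:+_ to _⊕_; _:*_ to _⊗_; _:=_ to _⊜_)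

  coeff-+ₚ : ∀ f g n → coeff (f +ₚ g) n ≈ coeff f n + coeff g n
  coeff-+ₚ []      g       n       = sym (+-identityˡ _)
  coeff-+ₚ (x ∷ f) []      n       = sym (+-identityʳ _)
  coeff-+ₚ (x ∷ f) (y ∷ g) zero    = ≈-refl
  coeff-+ₚ (x ∷ f) (y ∷ g) (suc n) = coeff-+ₚ f g n

  coeff-scale : ∀ x f n → coeff (map (x *_) f) n ≈ x * coeff f n
  coeff-scale x []      n       = sym (zeroʳ x)
  coeff-scale x (y ∷ f) zero    = ≈-refl
  coeff-scale x (y ∷ f) (suc n) = coeff-scale x f n

  coeff-X-* : ∀ r f n → coeff ((X- r) *ₚ f) (suc n) ≈ - r * coeff f (suc n) + coeff f n
  coeff-X-* r f n = begin
    coeff ((X- r) *ₚ f) (suc n)   ≈⟨ coeff-+ₚ (map (- r *_) f) _ (suc n) ⟩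
    coeff (map (- r *_) f) (suc n) + coeff (map (1# *_) f +ₚ (0# ∷ [])) n
      ≈⟨ +-cong (coeff-scale (- r) f (suc n)) (coeff-+ₚ (map (1# *_) f) _ n) ⟩
    - r * coeff f (suc n) + (coeff (map (1# *_) f) n + coeff (0# ∷ []) n)
      ≈⟨ +-congˡ (+-cong (trans (coeff-scale 1# f n) (*-identityˡ _)) (coeff-0 n)) ⟩
    - r * coeff f (suc n) + (coeff f n + 0#)   ≈⟨ +-congˡ (+-identityʳ _) ⟩
    - r * coeff f (suc n) + coeff f n          ∎
    where
    coeff-0 : ∀ n → coeff (0# ∷ []) n ≈ 0#
    coeff-0 zero    = ≈-refl
    coeff-0 (suc n) = ≈-refl

  coeff-X-*-0 : ∀ r f → coeff ((X- r) *ₚ f) 0 ≈ - r * coeff f 0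
  coeff-X-*-0 r f = trans (coeff-+ₚ (map (- r *_) f) _ 0) (trans (+-identityʳ _) (coeff-scale (- r) f 0))

  coeff-∏-above : ∀ rs {n} → length rs < n → coeff ∏[X- rs ] n ≈ 0#
  coeff-∏-above []       {suc n} _       = ≈-refl
  coeff-∏-above (r ∷ rs) {suc n} (s≤s l) = begin
    coeff ∏[X- r ∷ rs ] (suc n)                           ≈⟨ coeff-X-* r ∏[X- rs ] n ⟩
    - r * coeff ∏[X- rs ] (suc n) + coeff ∏[X- rs ] n     ≈⟨ +-cong (*-congˡ (coeff-∏-above rs (ℕ.m<n⇒m<1+n l))) (coeff-∏-above rs l) ⟩
    - r * 0# + 0#                                         ≈⟨ trans (+-identityʳ _) (zeroʳ _) ⟩
    0#                                                    ∎

  coeff-∏-leading : ∀ rs → coeff ∏[X- rs ] (length rs) ≈ 1#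
  coeff-∏-leading []       = ≈-refl
  coeff-∏-leading (r ∷ rs) = begin
    coeff ∏[X- r ∷ rs ] (suc n)                           ≈⟨ coeff-X-* r ∏[X- rs ] n ⟩
    - r * coeff ∏[X- rs ] (suc n) + coeff ∏[X- rs ] n     ≈⟨ +-cong (*-congˡ (coeff-∏-above rs ℕ.≤-refl)) (coeff-∏-leading rs) ⟩
    - r * 0# + 1#                                         ≈⟨ trans (+-congʳ (zeroʳ _)) (+-identityˡ 1#) ⟩
    1#                                                    ∎
    where n = length rs

  -- A splitting field lists its roots without saying how many there are. If the degrees disagreed,
  -- the leading 1 of the longer polynomial would face a 0 in the other one.
  length-roots : ¬ (1# ≈ 0#) → ∀ {f} rs d → f ≈ₚ ∏[X- rs ] →
    coeff f d ≈ 1# → (∀ {n} → d < n → coeff f n ≈ 0#) → length rs ≡ d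
  length-roots 1≉0 rs d f≈ leading above with ℕ.<-cmp (length rs) d
  ... | tri≈ _ eq _ = eq
  ... | tri< l _ _ = contradiction (trans (sym leading) (trans (f≈ d) (coeff-∏-above rs l))) 1≉0
  ... | tri> _ _ g = contradiction (trans (sym (coeff-∏-leading rs)) (trans (sym (f≈ (length rs))) (above g))) 1≉0

  module _ {x y z : Carrier} where
    private
      x′ = - x
      y′ = - y
      z′ = - z
      f = ∏[X- x ∷ y ∷ z ∷ [] ]

    coeff₂-∏ : coeff f 2 ≈ x′ + y′ + z′
    coeff₂-∏ = begin
      coeff f 2   ≈⟨ coeff-X-* x ∏[X- y ∷ z ∷ [] ] 1 ⟩
      x′ * coeff ∏[X- y ∷ z ∷ [] ] 2 + coeff ∏[X- y ∷ z ∷ [] ] 1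
        ≈⟨ +-cong (*-congˡ (coeff-∏-leading (y ∷ z ∷ []))) (trans (coeff-X-* y ∏[X- z ∷ [] ] 0)
             (+-cong (*-congˡ (coeff-∏-leading (z ∷ []))) (coeff-X-*-0 z ∏[X- [] ]))) ⟩
      x′ * 1# + (y′ * 1# + z′ * 1#)
        ≈⟨ solve 3 (λ x y z → ((x ⊗ con 1) ⊕ ((y ⊗ con 1) ⊕ (z ⊗ con 1))) ⊜ ((x ⊕ y) ⊕ z)) ≈-refl x′ y′ z′ ⟩
      x′ + y′ + z′   ∎

    coeff₁-∏ : coeff f 1 ≈ x′ * y′ + y′ * z′ + z′ * x′
    coeff₁-∏ = begin
      coeff f 1   ≈⟨ coeff-X-* x ∏[X- y ∷ z ∷ [] ] 0 ⟩
      x′ * coeff ∏[X- y ∷ z ∷ [] ] 1 + coeff ∏[X- y ∷ z ∷ [] ] 0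
        ≈⟨ +-cong (*-congˡ (trans (coeff-X-* y ∏[X- z ∷ [] ] 0)
             (+-cong (*-congˡ (coeff-∏-leading (z ∷ []))) (coeff-X-*-0 z ∏[X- [] ]))))
             (trans (coeff-X-*-0 y ∏[X- z ∷ [] ]) (*-congˡ (coeff-X-*-0 z ∏[X- [] ]))) ⟩
      x′ * (y′ * 1# + z′ * 1#) + y′ * (z′ * 1#)
        ≈⟨ solve 3 (λ x y z → ((x ⊗ ((y ⊗ con 1) ⊕ (z ⊗ con 1))) ⊕ (y ⊗ (z ⊗ con 1))) ⊜ (((x ⊗ y) ⊕ (y ⊗ z)) ⊕ (z ⊗ x))) ≈-refl x′ y′ z′ ⟩
      x′ * y′ + y′ * z′ + z′ * x′   ∎

    coeff₀-∏ : coeff f 0 ≈ x′ * y′ * z′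
    coeff₀-∏ = begin
      coeff f 0   ≈⟨ coeff-X-*-0 x ∏[X- y ∷ z ∷ [] ] ⟩
      x′ * coeff ∏[X- y ∷ z ∷ [] ] 0
        ≈⟨ *-congˡ (trans (coeff-X-*-0 y ∏[X- z ∷ [] ]) (*-congˡ (coeff-X-*-0 z ∏[X- [] ]))) ⟩
      x′ * (y′ * (z′ * 1#))
        ≈⟨ solve 3 (λ x y z → (x ⊗ (y ⊗ (z ⊗ con 1))) ⊜ ((x ⊗ y) ⊗ z)) ≈-refl x′ y′ z′ ⟩
      x′ * y′ * z′   ∎

  neg-square : ∀ x → - x * - x ≈ x * x
  neg-square x = begin
    - x * - x       ≈⟨ -‿distribˡ-* x (- x) ⟨
    - (x * - x)     ≈⟨ -‿cong (-‿distribʳ-* x x) ⟨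
    - - (x * x)     ≈⟨ -‿involutive (x * x) ⟩
    x * x           ∎

  module _ {x y z : Carrier} where
    private
      x′ = - x
      y′ = - y
      z′ = - z
      f = ∏[X- x ∷ y ∷ z ∷ [] ]
      e₁ = x′ + y′ + z′
      e₂ = x′ * y′ + y′ * z′ + z′ * x′
      e₃ = x′ * y′ * z′

    sum-roots : coeff f 2 ≈ - 1# → x + y + z ≈ 1#
    sum-roots c₂ = begin
      x + y + z       ≈⟨ -‿involutive _ ⟨
      - - (x + y + z) ≈⟨ -‿cong (trans (+-congʳ (-‿+-comm x y)) (-‿+-comm (x + y) z)) ⟨
      - e₁            ≈⟨ -‿cong (trans (sym coeff₂-∏) c₂) ⟩
      - - 1#          ≈⟨ -‿involutive 1# ⟩
      1#              ∎

    sum-squares : coeff f 2 ≈ - 1# → coeff f 1 ≈ - 1# → x * x + y * y + z * z ≈ 1# + 1# + 1#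
    sum-squares c₂ c₁ = begin
      x * x + y * y + z * z           ≈⟨ +-cong (+-cong (neg-square x) (neg-square y)) (neg-square z) ⟨
      -- Newton's e₁² - 2e₂, arranged for a solver without subtraction: since e₂ = -1, the inserted
      -- zero becomes (e₂ + e₂) + (1 + 1), and P + 2e₂ is e₁².
      P                               ≈⟨ trans (+-congˡ (-‿inverseˡ (1# + 1#))) (+-identityʳ P) ⟨
      P + (- (1# + 1#) + (1# + 1#))   ≈⟨ +-congˡ (+-congʳ (trans (sym (-‿+-comm 1# 1#)) (sym (+-cong e₂≈ e₂≈)))) ⟩
      P + ((e₂ + e₂) + (1# + 1#))     ≈⟨ solve 4 (λ x y z i →
          ((((x ⊗ x) ⊕ (y ⊗ y)) ⊕ (z ⊗ z)) ⊕ (((((x ⊗ y) ⊕ (y ⊗ z)) ⊕ (z ⊗ x)) ⊕ (((x ⊗ y) ⊕ (y ⊗ z)) ⊕ (z ⊗ x))) ⊕ (i ⊕ i)))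
          ⊜ (((((x ⊕ y) ⊕ z) ⊗ ((x ⊕ y) ⊕ z)) ⊕ i) ⊕ i)) ≈-refl x′ y′ z′ 1# ⟩
      e₁ * e₁ + 1# + 1#               ≈⟨ +-congʳ (+-congʳ (trans (*-cong e₁≈ e₁≈) (trans (neg-square 1#) (*-identityˡ 1#)))) ⟩
      1# + 1# + 1#                    ∎
      where
      P = x′ * x′ + y′ * y′ + z′ * z′
      e₁≈ : e₁ ≈ - 1#
      e₁≈ = trans (sym coeff₂-∏) c₂
      e₂≈ : e₂ ≈ - 1#
      e₂≈ = trans (sym coeff₁-∏) c₁

    eval-∏ : ∀ t → e₃ + t * (e₂ + t * (e₁ + t * (1# + t * 0#))) ≈ (t + x′) * (t + y′) * (t + z′)
    eval-∏ t = solve 4 (λ t x y z →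
      (((x ⊗ y) ⊗ z) ⊕ (t ⊗ ((((x ⊗ y) ⊕ (y ⊗ z)) ⊕ (z ⊗ x)) ⊕ (t ⊗ (((x ⊕ y) ⊕ z) ⊕ (t ⊗ (con 1 ⊕ (t ⊗ con 0))))))))
      ⊜ (((t ⊕ x) ⊗ (t ⊕ y)) ⊗ (t ⊕ z))) ≈-refl t x′ y′ z′

    root-eval : ∀ {c₀ c₁ c₂ c₃} → (c₀ ∷ c₁ ∷ c₂ ∷ c₃ ∷ []) ≈ₚ f →
      ∀ t → (t + x′) * (t + y′) * (t + z′) ≈ 0# → eval (c₀ ∷ c₁ ∷ c₂ ∷ c₃ ∷ []) t ≈ 0#
    root-eval f≈ t e = trans
      (+-cong (trans (f≈ 0) coeff₀-∏) (*-congˡ (+-cong (trans (f≈ 1) coeff₁-∏) (*-congˡ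
        (+-cong (trans (f≈ 2) coeff₂-∏) (*-congˡ (+-congʳ (trans (f≈ 3) (coeff-∏-leading (x ∷ y ∷ z ∷ []))))))))))
      (trans (eval-∏ t) e)

    root₁ : (x + x′) * (x + y′) * (x + z′) ≈ 0#
    root₁ = trans (*-congʳ (trans (*-congʳ (-‿inverseʳ x)) (zeroˡ _))) (zeroˡ _)

    root₂ : (y + x′) * (y + y′) * (y + z′) ≈ 0#
    root₂ = trans (*-congʳ (trans (*-congˡ (-‿inverseʳ y)) (zeroʳ _))) (zeroˡ _)

    root₃ : (z + x′) * (z + y′) * (z + z′) ≈ 0#
    root₃ = trans (*-congˡ (-‿inverseʳ z)) (zeroʳ _)

  CubeRule : Carrier → Set _
  CubeRule x = x * (x * x) ≈ x * x + x + 1#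

  cube-rule : ∀ {c₀ c₁ c₂ c₃ x} → c₀ ≈ - 1# → c₁ ≈ - 1# → c₂ ≈ - 1# → c₃ ≈ 1# →
    eval (c₀ ∷ c₁ ∷ c₂ ∷ c₃ ∷ []) x ≈ 0# → CubeRule x
  cube-rule {c₀} {c₁} {c₂} {c₃} {x} e₀ e₁ e₂ e₃ root = begin
    -- Horner form in which each 0 is about to become cᵢ + 1; collecting these 1s splits off x² + x
    -- + 1 and leaves the value of the polynomial.
    x * (x * x)       ≈⟨ solve 1 (λ x → (x ⊗ (x ⊗ x)) ⊜ (con 0 ⊕ (x ⊗ (con 0 ⊕ (x ⊗ (con 0 ⊕ x)))))) ≈-refl x ⟩
    0# + x * (0# + x * (0# + x))
      ≈⟨ +-cong (vanish e₀) (*-congˡ (+-cong (vanish e₁) (*-congˡ (+-cong (vanish e₂) (trans (*-congˡ e₃) (*-identityʳ x)))))) ⟨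
    (c₀ + 1#) + x * ((c₁ + 1#) + x * ((c₂ + 1#) + x * c₃))
      ≈⟨ solve 5 (λ a b c d x →
        ((a ⊕ con 1) ⊕ (x ⊗ ((b ⊕ con 1) ⊕ (x ⊗ ((c ⊕ con 1) ⊕ (x ⊗ d))))))
        ⊜ ((a ⊕ (x ⊗ (b ⊕ (x ⊗ (c ⊕ (x ⊗ (d ⊕ (x ⊗ con 0)))))))) ⊕ (((x ⊗ x) ⊕ x) ⊕ con 1))) ≈-refl c₀ c₁ c₂ c₃ x ⟩
    eval (c₀ ∷ c₁ ∷ c₂ ∷ c₃ ∷ []) x + (x * x + x + 1#)   ≈⟨ trans (+-congʳ root) (+-identityˡ _) ⟩
    x * x + x + 1#    ∎
    where
    vanish : ∀ {m} → m ≈ - 1# → m + 1# ≈ 0#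
    vanish m≈ = trans (+-congʳ m≈) (-‿inverseˡ 1#)

  -- The constant term -1 makes a root invertible, with an inverse that is a polynomial in the root
  -- and therefore integral as well. This places the roots in the unit group of 𝒪/p.
  cube-rule-inverse : ∀ {x} → CubeRule x → x * (x * x - x - 1#) ≈ 1#
  cube-rule-inverse {x} rule = begin
    x * (x * x - x - 1#)                            ≈⟨ solve 3 (λ x m n → (x ⊗ (((x ⊗ x) ⊕ m) ⊕ n)) ⊜ ((x ⊗ (x ⊗ x)) ⊕ ((x ⊗ m) ⊕ (x ⊗ n)))) ≈-refl x (- x) (- 1#) ⟩
    x * (x * x) + (x * - x + x * - 1#)              ≈⟨ +-cong rule (+-cong (sym (-‿distribʳ-* x x)) (trans (sym (-‿distribʳ-* x 1#)) (-‿cong (*-identityʳ x)))) ⟩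
    (x * x + x + 1#) + (- (x * x) + - x)            ≈⟨ solve 5 (λ a b m n i → (((a ⊕ b) ⊕ i) ⊕ (m ⊕ n)) ⊜ (((a ⊕ m) ⊕ (b ⊕ n)) ⊕ i)) ≈-refl (x * x) x (- (x * x)) (- x) 1# ⟩
    (x * x - x * x) + (x - x) + 1#                  ≈⟨ +-congʳ (+-cong (-‿inverseʳ (x * x)) (-‿inverseʳ x)) ⟩
    0# + 0# + 1#                                    ≈⟨ trans (+-congʳ (+-identityˡ 0#)) (+-identityˡ 1#) ⟩
    1#                                              ∎

  -- Powers and power sums of the roots

  open Exp semiring using (_^_; ^-homo-*)

  ^-recurrence : ∀ {x} → CubeRule x → ∀ n → x ^ (3 ℕ.+ n) ≈ x ^ (2 ℕ.+ n) + x ^ (1 ℕ.+ n) + x ^ n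
  ^-recurrence {x} rule n = begin
    x * (x * (x * y))           ≈⟨ solve 2 (λ x y → (x ⊗ (x ⊗ (x ⊗ y))) ⊜ ((x ⊗ (x ⊗ x)) ⊗ y)) ≈-refl x y ⟩
    (x * (x * x)) * y           ≈⟨ *-congʳ rule ⟩
    (x * x + x + 1#) * y        ≈⟨ solve 2 (λ x y → ((((x ⊗ x) ⊕ x) ⊕ con 1) ⊗ y) ⊜ (((x ⊗ (x ⊗ y)) ⊕ (x ⊗ y)) ⊕ y)) ≈-refl x y ⟩
    x * (x * y) + x * y + y     ∎
    where y = x ^ n

  interchange₃ : ∀ a b c d e f → (a + b + c) + (d + e + f) ≈ (a + d) + (b + e) + (c + f)
  interchange₃ a b c d e f = trans (interchange (a + b) c (d + e) f) (+-congʳ (interchange a b d e))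

  power-sum : (x y z : Carrier) → ℕ → Carrier
  power-sum x y z n = x ^ n + y ^ n + z ^ n

  power-sum-recurrence : ∀ {x y z} → CubeRule x → CubeRule y → CubeRule z → ∀ n →
    power-sum x y z (3 ℕ.+ n) ≈ power-sum x y z (2 ℕ.+ n) + power-sum x y z (1 ℕ.+ n) + power-sum x y z n
  power-sum-recurrence {x} {y} {z} rx ry rz n = begin
    power-sum x y z (3 ℕ.+ n)   ≈⟨ +-cong (+-cong (^-recurrence rx n) (^-recurrence ry n)) (^-recurrence rz n) ⟩
    (x ^ (2 ℕ.+ n) + x ^ (1 ℕ.+ n) + x ^ n) + (y ^ (2 ℕ.+ n) + y ^ (1 ℕ.+ n) + y ^ n) + (z ^ (2 ℕ.+ n) + z ^ (1 ℕ.+ n) + z ^ n)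
      ≈⟨ +-congʳ (interchange₃ (x ^ (2 ℕ.+ n)) (x ^ (1 ℕ.+ n)) (x ^ n) (y ^ (2 ℕ.+ n)) (y ^ (1 ℕ.+ n)) (y ^ n)) ⟩
    (x ^ (2 ℕ.+ n) + y ^ (2 ℕ.+ n)) + (x ^ (1 ℕ.+ n) + y ^ (1 ℕ.+ n)) + (x ^ n + y ^ n) + (z ^ (2 ℕ.+ n) + z ^ (1 ℕ.+ n) + z ^ n)
      ≈⟨ interchange₃ _ _ _ (z ^ (2 ℕ.+ n)) (z ^ (1 ℕ.+ n)) (z ^ n) ⟩
    power-sum x y z (2 ℕ.+ n) + power-sum x y z (1 ℕ.+ n) + power-sum x y z n   ∎

  power-sum-1 : ∀ {x y z} → coeff ∏[X- x ∷ y ∷ z ∷ [] ] 2 ≈ - 1# → power-sum x y z 1 ≈ 1#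
  power-sum-1 {x} {y} {z} c₂ =
    trans (+-cong (+-cong (*-identityʳ x) (*-identityʳ y)) (*-identityʳ z)) (sum-roots c₂)

  power-sum-2 : ∀ {x y z} → coeff ∏[X- x ∷ y ∷ z ∷ [] ] 2 ≈ - 1# → coeff ∏[X- x ∷ y ∷ z ∷ [] ] 1 ≈ - 1# →
    power-sum x y z 2 ≈ 1# + 1# + 1#
  power-sum-2 {x} {y} {z} c₂ c₁ = trans
    (+-cong (+-cong (*-congˡ (*-identityʳ x)) (*-congˡ (*-identityʳ y))) (*-congˡ (*-identityʳ z))) (sum-squares c₂ c₁)

  -- The quotient stays explicit, so that its integrality can be read off from that of `x` and `q`.
  shifted-power : ∀ {x q r} k n → q * r ≈ x ^ n - 1# → (x ^ k * q) * r ≈ x ^ (k ℕ.+ n) - x ^ k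
  shifted-power {x} {q} {r} k n e = begin
    (x ^ k * q) * r              ≈⟨ *-assoc (x ^ k) q r ⟩
    x ^ k * (q * r)              ≈⟨ *-congˡ e ⟩
    x ^ k * (x ^ n - 1#)         ≈⟨ x[y-z]≈xy-xz (x ^ k) (x ^ n) 1# ⟩
    x ^ k * x ^ n - x ^ k * 1#   ≈⟨ +-cong (sym (^-homo-* x k n)) (-‿cong (*-identityʳ (x ^ k))) ⟩
    x ^ (k ℕ.+ n) - x ^ k        ∎

  sum-of-differences : ∀ {q q′ q″ r a b c a′ b′ c′} → q * r ≈ a - a′ → q′ * r ≈ b - b′ → q″ * r ≈ c - c′ →
    (q + q′ + q″) * r ≈ (a + b + c) - (a′ + b′ + c′)
  sum-of-differences {q} {q′} {q″} {r} {a} {b} {c} {a′} {b′} {c′} e e′ e″ = begin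
    (q + q′ + q″) * r                     ≈⟨ trans (distribʳ r (q + q′) q″) (+-congʳ (distribʳ r q q′)) ⟩
    q * r + q′ * r + q″ * r               ≈⟨ +-cong (+-cong e e′) e″ ⟩
    (a - a′) + (b - b′) + (c - c′)        ≈⟨ trans (+-congʳ (interchange a (- a′) b (- b′))) (interchange (a + b) (- a′ - b′) c (- c′)) ⟩
    (a + b + c) + (- a′ - b′ - c′)        ≈⟨ +-congˡ (trans (+-congʳ (-‿+-comm a′ b′)) (-‿+-comm (a′ + b′) c′)) ⟩
    (a + b + c) - (a′ + b′ + c′)          ∎

module _ {c′ ℓ′} (O : CommutativeRing c ℓ) (L : CommutativeRing c′ ℓ′)
         (f : CommutativeRing.Carrier O → CommutativeRing.Carrier L) where
  private
    module O = CommutativeRing O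
    module L = CommutativeRing L
  open RawMonoid O.+-rawMonoid using () renaming (_×_ to _·ᴼ_)
  open RawMonoid L.+-rawMonoid using () renaming (_×_ to _·ᴸ_)

  ×-image : f O.0# L.≈ L.0# → (∀ x y → f (x O.+ y) L.≈ f x L.+ f y) →
            ∀ n x → f (n ·ᴼ x) L.≈ n ·ᴸ f x
  ×-image f-0 f-+ zero    x = f-0
  ×-image f-0 f-+ (suc n) x = L.trans (f-+ x (n ·ᴼ x)) (L.+-congˡ (×-image f-0 f-+ n x))

-- Roots of unity modulo p in the Tribonacci field

-- The initial values are Newton's: the number of roots, e₁ = 1, and e₁² - 2e₂ = 1 + 2.
S : ℕ → ℤ
S 0 = + 3
S 1 = + 1
S 2 = + 3
S (suc (suc (suc n))) = S (suc (suc n)) ℤ.+ S (suc n) ℤ.+ S n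

module _ (R : CommutativeRing c ℓ) where
  open CommutativeRing R
  open Polynomials R using (coeff; ∏[X-_])

  power-sum-S : ∀ {x y z} → CubeRule R x → CubeRule R y → CubeRule R z →
    coeff ∏[X- x ∷ y ∷ z ∷ [] ] 2 ≈ - 1# → coeff ∏[X- x ∷ y ∷ z ∷ [] ] 1 ≈ - 1# →
    (θ : ℤ → Carrier) → θ (+ 1) ≈ 1# → (∀ m n → θ (m ℤ.+ n) ≈ θ m + θ n) →
    ∀ n → θ (S n) ≈ power-sum R x y z n
  power-sum-S {x} {y} {z} rx ry rz c₂ c₁ θ θ-1 θ-+ = go
    where
    θ-3 : θ (+ 3) ≈ 1# + 1# + 1#
    θ-3 = trans (θ-+ (+ 2) (+ 1)) (+-cong (trans (θ-+ (+ 1) (+ 1)) (+-cong θ-1 θ-1)) θ-1)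
    go : ∀ n → θ (S n) ≈ power-sum R x y z n
    go 0 = θ-3
    go 1 = trans θ-1 (sym (power-sum-1 R c₂))
    go 2 = trans θ-3 (sym (power-sum-2 R c₂ c₁))
    go (suc (suc (suc n))) = trans
      (trans (θ-+ (S (suc (suc n)) ℤ.+ S (suc n)) (S n)) (+-congʳ (θ-+ (S (suc (suc n))) (S (suc n)))))
      (trans (+-cong (+-cong (go (suc (suc n))) (go (suc n))) (go n)) (sym (power-sum-recurrence R rx ry rz n)))

module _ {c ℓ₁ ℓ₂} (p : ℕ) (p-prime : Prime p) (F : TribonacciField p p-prime c ℓ₁ ℓ₂) where
  open PAdic p p-prime using (ℚₚ; ℤₚ→ℚₚ; ℤₚ→ℚₚ-homo)
  open SplittingField F using (ι; ι-mono; roots; splits; IsRoot)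
  private
    L = SplittingField.ring F
    module ℤₚ = CommutativeRing (ℤₚ p)
    module ι = IsRingMonomorphism ι-mono
    module 𝒪 = CommutativeRing (𝒪 p p-prime F)
  open CommutativeRing L
  open Polynomials L using (eval; ∏[X-_]; _≈ₚ_)
  open Exp semiring using (_^_)
  open SemiringSolver commutativeSemiring using (solve) renaming (_:+_ to _⊕_; _:*_ to _⊗_; _:=_ to _⊜_)
  open SetoidReasoning setoid
  open PAdicInteger using (seq)
  private f = Polynomials.tribonacci ℚₚ

  -- The integers inside the field, and p𝒪 ∩ ℤ = pℤ

  φ : ℤₚ.Carrier → Carrier
  φ = ι ∘ ℤₚ→ℚₚ

  φ-homo : IsRingHomomorphism ℤₚ.rawRing rawRing φ
  φ-homo = Composition.isRingHomomorphism trans ℤₚ→ℚₚ-homo ι.isRingHomomorphism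

  private module φ = IsRingHomomorphism φ-homo

  open IntegralClosure (ℤₚ p) L φ-homo using (Integral; integral-+; integral-*)

  θ : ℤ → Carrier
  θ = φ ∘ fromℤ p

  θ-+ : ∀ x y → θ (x ℤ.+ y) ≈ θ x + θ y
  θ-+ x y = trans (φ.⟦⟧-cong {fromℤ p (x ℤ.+ y)} {fromℤ p x ℤₚ.+ fromℤ p y} λ n → divides (+ 0) (ℤ.+-inverseʳ (x ℤ.+ y)))
    (φ.+-homo (fromℤ p x) (fromℤ p y))

  -- An embedded p-adic integer has denominator exponent 0, so injectivity of `ι` gives an equality
  -- in ℤₚ itself; the final argument 1 reads it modulo p.
  φ-kernel : ∀ x → φ x ≈ 0# → + p ∣ seq x 1
  φ-kernel x φx≈0 = ≡.subst₂ _∣_ (≡.cong +_ (ℕ.*-identityʳ p)) (≡.trans (ℤ.+-identityʳ _) (ℤ.*-identityʳ (seq x 1)))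
    (ι.injective (trans φx≈0 (sym φ.0#-homo)) 1)

  θ-* : ∀ x y → θ (x ℤ.* y) ≈ θ x * θ y
  θ-* x y = trans (φ.⟦⟧-cong {fromℤ p (x ℤ.* y)} {fromℤ p x ℤₚ.* fromℤ p y} λ n → divides (+ 0) (ℤ.+-inverseʳ (x ℤ.* y)))
    (φ.*-homo (fromℤ p x) (fromℤ p y))

  -- pᵈ times a monic polynomial of degree d over ℤₚ at z, as a function of s = p z.
  homogenize : ℤ → List ℤₚ.Carrier → ℤₚ.Carrier
  homogenize s []       = ℤₚ.1#
  homogenize s (x ∷ as) = x ℤₚ.* fromℤ p (+ (p ℕ.^ suc (length as))) ℤₚ.+ fromℤ p s ℤₚ.* homogenize s as

  φ-homogenize : ∀ {z s} → z * θ (+ p) ≈ θ s → ∀ as →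
    θ (+ (p ℕ.^ length as)) * eval (map φ (as ++ [ ℤₚ.1# ])) z ≈ φ (homogenize s as)
  φ-homogenize {z} {s} zp≈s [] = begin
    φ ℤₚ.1# * (φ ℤₚ.1# + z * 0#)   ≈⟨ *-cong φ.1#-homo (+-congˡ (zeroʳ z)) ⟩
    1# * (φ ℤₚ.1# + 0#)            ≈⟨ trans (*-identityˡ _) (+-identityʳ _) ⟩
    φ ℤₚ.1#                        ∎
  φ-homogenize {z} {s} zp≈s (x ∷ as) = begin
    θ P′ * (φ x + z * E)                ≈⟨ distribˡ _ _ _ ⟩
    θ P′ * φ x + θ P′ * (z * E)         ≈⟨ +-cong (*-comm _ _) (*-congʳ (trans (reflexive (≡.cong θ (ℤ.pos-* p (p ℕ.^ length as)))) (θ-* (+ p) P))) ⟩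
    φ x * θ P′ + (θ (+ p) * θ P) * (z * E)
      ≈⟨ +-congˡ (solve 4 (λ p q z e → ((p ⊗ q) ⊗ (z ⊗ e)) ⊜ ((z ⊗ p) ⊗ (q ⊗ e))) refl (θ (+ p)) (θ P) z E) ⟩
    φ x * θ P′ + (z * θ (+ p)) * (θ P * E)
      ≈⟨ +-congˡ (*-cong zp≈s (φ-homogenize zp≈s as)) ⟩
    φ x * θ P′ + θ s * φ (homogenize s as)
      ≈⟨ +-cong (φ.*-homo x (fromℤ p P′)) (φ.*-homo (fromℤ p s) (homogenize s as)) ⟨
    φ (x ℤₚ.* fromℤ p P′) + φ (fromℤ p s ℤₚ.* homogenize s as)
      ≈⟨ φ.+-homo (x ℤₚ.* fromℤ p P′) (fromℤ p s ℤₚ.* homogenize s as) ⟨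
    φ (homogenize s (x ∷ as))           ∎
    where
    P P′ : ℤ
    P  = + (p ℕ.^ length as)
    P′ = + (p ℕ.^ suc (length as))
    E : Carrier
    E = eval (map φ (as ++ [ ℤₚ.1# ])) z

  -- Modulo p the homogenized polynomial is a power of s, and Euclid's lemma peels off one factor s
  -- at a time. In degree 0 the premise is p ∣ 1, which gives any divisibility.
  p∣homogenize⇒p∣s : ∀ s as → + p ∣ seq (homogenize s as) 1 → + p ∣ s
  p∣homogenize⇒p∣s s []       p∣1 = ℤ∣.∣-trans p∣1 (divides s (≡.sym (ℤ.*-identityʳ s)))
  p∣homogenize⇒p∣s s (x ∷ as) p∣h
    with euclidsLemma ℤ.∣ s ∣ ℤ.∣ H ∣ p-prime (≡.subst (p ℕ.∣_) (ℤ.abs-* s H) (ℤ∣.∣⇒∣ᵤ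
           (ℤ∣.∣m+n∣m⇒∣n p∣h (ℤ∣.∣n⇒∣m*n (seq x 1) (ℤ∣.∣ᵤ⇒∣ (ℕ.m∣m*n (p ℕ.^ length as)))))))
    where H = seq (homogenize s as) 1
  ... | inj₁ p∣s = ℤ∣.∣ᵤ⇒∣ p∣s
  ... | inj₂ p∣H = p∣homogenize⇒p∣s s as (ℤ∣.∣ᵤ⇒∣ p∣H)

  -- This is p𝒪 ∩ ℤ = pℤ, with z in the role of s / p: clearing denominators in the integral
  -- equation of z leaves a congruence for s alone.
  integral-quotient : ∀ {z s} → Integral z → z * θ (+ p) ≈ θ s → + p ∣ s
  integral-quotient {z} {s} (as , root) zp≈s = p∣homogenize⇒p∣s s as (φ-kernel (homogenize s as)
    (trans (sym (φ-homogenize zp≈s as)) (trans (*-congˡ root) (zeroʳ _))))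

  -- Negation and embedding in `ℚₚ` act on numerators only, so both coefficient lists agree
  -- definitionally and `root` fits unchanged.
  root⇒integral : ∀ {x} → IsRoot x → Integral x
  root⇒integral root = ℤₚ.- ℤₚ.1# ∷ ℤₚ.- ℤₚ.1# ∷ ℤₚ.- ℤₚ.1# ∷ [] , root

  ι-1 : ι (CommutativeRing.1# ℚₚ) ≈ 1#
  ι-1 = ι.1#-homo

  ι--1 : ι (CommutativeRing.-_ ℚₚ (CommutativeRing.1# ℚₚ)) ≈ - 1#
  ι--1 = trans (ι.-‿homo (CommutativeRing.1# ℚₚ)) (-‿cong ι-1)

  root⇒cube-rule : ∀ {x} → IsRoot x → CubeRule L x
  root⇒cube-rule = cube-rule L ι--1 ι--1 ι--1 ι-1

  -- Powers of a root modulo p𝒪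

  open RawMonoid 𝒪.+-rawMonoid using () renaming (_×_ to _·_)
  open RawMonoid +-rawMonoid using () renaming (_×_ to _·ᴸ_)

  ×-θ : ∀ n → n ·ᴸ 1# ≈ θ (+ n)
  ×-θ zero    = sym φ.0#-homo
  ×-θ (suc n) = begin
    1# + n ·ᴸ 1#         ≈⟨ +-cong (sym φ.1#-homo) (×-θ n) ⟩
    θ (+ 1) + θ (+ n)    ≈⟨ θ-+ (+ 1) (+ n) ⟨
    θ (+ 1 ℤ.+ + n)      ∎

  private G = rootGroup p p-prime F

  value : Group.Carrier G → Carrier
  value g = proj₁ (proj₁ (proj₁ g))

  zero-quotient : ∀ {x y} r → x ≈ y → 0# * r ≈ x - y
  zero-quotient {x} {y} r x≈y = trans (zeroˡ r) (sym (trans (+-congʳ x≈y) (-‿inverseʳ y)))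

  proj₁-· : ∀ n (x : 𝒪.Carrier) → proj₁ (n · x) ≈ n ·ᴸ proj₁ x
  proj₁-· = ×-image (𝒪 p p-prime F) L proj₁ refl (λ x y → refl)

  G-comm : ∀ x y → Group._≈_ G (Group._∙_ G x y) (Group._∙_ G y x)
  G-comm x y = record { quotient = 𝒪.0# ; equality = zero-quotient (proj₁ (p · 𝒪.1#)) (*-comm (value x) (value y)) }

  π≈p : proj₁ (p · 𝒪.1#) ≈ p ·ᴸ 1#
  π≈p = proj₁-· p 𝒪.1#

  rebase : ∀ {q w v} → w ≈ p ·ᴸ 1# → q * w ≈ v → q * θ (+ p) ≈ v
  rebase w≈ e = trans (*-congˡ (trans (sym (×-θ p)) (sym w≈))) e

  -- Congruence to 1 modulo p𝒪, restated inside the field with `θ (+ p)` in place of the p-fold sum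
  -- of 1, which is the form that `integral-quotient` takes.
  OneModP : Carrier → Set _
  OneModP v = ∃[ q ] Integral q × q * θ (+ p) ≈ v - 1#

  one-mod-p-resp : ∀ {u v} → u ≈ v → OneModP u → OneModP v
  one-mod-p-resp u≈v (q , i , e) = q , i , trans e (+-congʳ u≈v)

  one-mod-p : ∀ {v} (q : 𝒪.Carrier) → proj₁ q * proj₁ (p · 𝒪.1#) ≈ v - 1# → OneModP v
  one-mod-p {v} q e = proj₁ q , proj₂ q , rebase {proj₁ q} {proj₁ (p · 𝒪.1#)} {v - 1#} π≈p e

  module _ {N : ℕ} (order : HasOrder G N) where
    generated-power : ∀ g → OneModP (value g ^ N)
    generated-power = lagrange-image G G-comm L value refl (λ x y → refl) OneModP one-mod-p-resp
      (λ x d → one-mod-p (RawMagma._∣ʳ_.quotient d) (RawMagma._∣ʳ_.equality d)) order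

    root-power : ∀ {x} → IsRoot x → OneModP (x ^ N)
    root-power {x} root = generated-power (u , gen (x𝒪 , root , record { quotient = 𝒪.0# ; equality = zero-quotient π refl }))
      where
      π : Carrier
      π = proj₁ (p · 𝒪.1#)
      x𝒪 x⁻¹ : 𝒪.Carrier
      x𝒪 = x , root⇒integral root
      x⁻¹ = x𝒪 𝒪.* x𝒪 𝒪.- x𝒪 𝒪.- 𝒪.1#
      u : AbelianGroup.Carrier (Units (𝒪/p p p-prime F))
      u = x𝒪 , x⁻¹ , record { quotient = 𝒪.0# ; equality = zero-quotient π (cube-rule-inverse L (root⇒cube-rule root)) }

  θ-- : ∀ x y → θ (x ℤ.- y) ≈ θ x - θ y
  θ-- x y = trans (θ-+ x (ℤ.- y)) (+-congˡ (trans (φ.⟦⟧-cong {fromℤ p (ℤ.- y)} {ℤₚ.- fromℤ p y} λ n → divides (+ 0) (ℤ.+-inverseʳ (ℤ.- y)))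
    (φ.-‿homo (fromℤ p y))))

  θ-1 : θ (+ 1) ≈ 1#
  θ-1 = φ.1#-homo

  1≉0 : ¬ 1# ≈ 0#
  1≉0 1≈0 = contradiction (ℕ.∣1⇒≡1 (ℤ∣.∣⇒∣ᵤ (φ-kernel ℤₚ.1# (trans φ.1#-homo 1≈0))))
    (ℕ.nonTrivial⇒≢1 {{prime⇒nonTrivial p-prime}})

  three-roots : ∃[ x ] ∃[ y ] ∃[ z ] map ι f ≈ₚ ∏[X- x ∷ y ∷ z ∷ [] ]
  three-roots = triple roots splits (length-roots L 1≉0 {map ι f} roots 3 splits ι-1 λ { (s≤s (s≤s (s≤s (s≤s z≤n)))) → refl })
    where
    triple : ∀ rs → map ι f ≈ₚ ∏[X- rs ] → length rs ≡ 3 →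
      ∃[ x ] ∃[ y ] ∃[ z ] map ι f ≈ₚ ∏[X- x ∷ y ∷ z ∷ [] ]
    triple (x ∷ y ∷ z ∷ []) f≈ _ = x , y , z , f≈

  integral-^ : ∀ {x} → Integral x → ∀ n → Integral (x ^ n)
  integral-^ int zero    = proj₂ 𝒪.1#
  integral-^ int (suc n) = integral-* int (integral-^ int n)

  module PowerSums {x y z : Carrier} (f≈ : map ι f ≈ₚ ∏[X- x ∷ y ∷ z ∷ [] ]) where

    x-root : IsRoot x
    x-root = root-eval L f≈ x (root₁ L)
    y-root : IsRoot y
    y-root = root-eval L f≈ y (root₂ L)
    z-root : IsRoot z
    z-root = root-eval L f≈ z (root₃ L)

    θ-S : ∀ n → θ (S n) ≈ power-sum L x y z n
    θ-S = power-sum-S L (root⇒cube-rule x-root) (root⇒cube-rule y-root) (root⇒cube-rule z-root)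
      (trans (sym (f≈ 2)) ι--1) (trans (sym (f≈ 1)) ι--1) θ θ-1 θ-+

    -- The difference divided by p is xᵏ (xᴺ - 1)/p plus the same for y and z. Each summand is
    -- integral, so `integral-quotient` applies to the sum.
    p∣ΔS : ∀ {N} → OneModP (x ^ N) → OneModP (y ^ N) → OneModP (z ^ N) → ∀ k → + p ∣ S (k ℕ.+ N) ℤ.- S k
    p∣ΔS {N} (q , q∈𝒪 , e) (r , r∈𝒪 , e′) (s , s∈𝒪 , e″) k =
      integral-quotient {x ^ k * q + y ^ k * r + z ^ k * s} {S (k ℕ.+ N) ℤ.- S k} integral (begin
        (x ^ k * q + y ^ k * r + z ^ k * s) * θ (+ p)
          ≈⟨ sum-of-differences L (shifted-power L k N e) (shifted-power L k N e′) (shifted-power L k N e″) ⟩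
        power-sum L x y z (k ℕ.+ N) - power-sum L x y z k   ≈⟨ +-cong (θ-S (k ℕ.+ N)) (-‿cong (θ-S k)) ⟨
        θ (S (k ℕ.+ N)) - θ (S k)                           ≈⟨ θ-- (S (k ℕ.+ N)) (S k) ⟨
        θ (S (k ℕ.+ N) ℤ.- S k)                             ∎)
      where
      factor : ∀ {t q} → IsRoot t → Integral q → Integral (t ^ k * q)
      factor root q∈𝒪 = integral-* (integral-^ (root⇒integral root) k) q∈𝒪
      integral : Integral (x ^ k * q + y ^ k * r + z ^ k * s)
      integral = integral-+ (integral-+ (factor x-root q∈𝒪) (factor y-root r∈𝒪)) (factor z-root s∈𝒪)

  power-sum-period : ∀ {N} → HasOrder (rootGroup p p-prime F) N → ∀ k → + p ∣ S (k ℕ.+ N) ℤ.- S k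
  power-sum-period order =
    let x , y , z , f≈ = three-roots
        open PowerSums f≈
    in p∣ΔS (root-power order x-root) (root-power order y-root) (root-power order z-root)

-- Differences of integral Tribonacci sequences

open import Data.Integer using (_+_; -_; _-_; _*_; ∣_∣; NonZero)
open import Data.Nat using (_^_)
open ℤ∣ using
  ( ∣m∣n⇒∣m+n; ∣m∣n⇒∣m-n; ∣m⇒∣-m; ∣n⇒∣m*n; ∣-trans; ∣ᵤ⇒∣; ∣⇒∣ᵤ; *-monoˡ-∣; *-monoʳ-∣; _∣?_ )
open ≡ using (refl; sym; trans; cong; cong₂; subst; subst₂; module ≡-Reasoning)

private variable
  s : ℤ → ℤ
  M q r : ℤ

record Trib (s : ℤ → ℤ) : Set where
  constructor trib
  field recurrence : ∀ n → s (n + + 3) ≡ s (n + + 2) + s (n + + 1) + s n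
open Trib public

Δ : ℤ → (ℤ → ℤ) → ℤ → ℤ
Δ M s n = s (n + M) - s n

-- The quantifier over all sequences is what makes iteration possible: the property is applied again
-- to differences divided by their modulus.
record Period (M q : ℤ) : Set where
  constructor period
  field divides-Δ : ∀ {s} → Trib s → ∀ n → q ∣ Δ M s n
open Period public

exchange : ∀ n M k → n + k + M ≡ n + M + k
exchange = solve-∀

Δ-trib : ∀ M → Trib s → Trib (Δ M s)
Δ-trib {s} M s-trib = trib λ n → begin
  s (n + + 3 + M) - s (n + + 3)                               ≡⟨ cong₂ _-_ (trans (cong s (exchange n M (+ 3))) (recurrence s-trib (n + M))) (recurrence s-trib n) ⟩
  (s (n + M + + 2) + s (n + M + + 1) + s (n + M)) - (s (n + + 2) + s (n + + 1) + s n)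
    ≡⟨ cong₂ (λ x y → x + y + s (n + M) - (s (n + + 2) + s (n + + 1) + s n))
         (cong s (exchange n M (+ 2))) (cong s (exchange n M (+ 1))) ⟨
  (s (n + + 2 + M) + s (n + + 1 + M) + s (n + M)) - (s (n + + 2) + s (n + + 1) + s n)
    ≡⟨ regroup (s (n + + 2 + M)) (s (n + + 1 + M)) (s (n + M)) (s (n + + 2)) (s (n + + 1)) (s n) ⟩
  Δ M s (n + + 2) + Δ M s (n + + 1) + Δ M s n                 ∎
  where
  open ≡-Reasoning
  regroup : ∀ x y z x′ y′ z′ → (x + y + z) - (x′ + y′ + z′) ≡ (x - x′) + (y - y′) + (z - z′)
  regroup = solve-∀

-- Divide s by r: the quotient is again a Tribonacci sequence.
period-scale : .{{NonZero r}} → Period M q → Trib s → (∀ n → r ∣ s n) → ∀ n → r * q ∣ Δ M s n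
period-scale {r} {M} {q} {s} per s-trib r∣s n =
  subst (r * q ∣_) (trans (distrib r (t (n + M)) (t n)) (cong₂ _-_ (sym (s≡ (n + M))) (sym (s≡ n))))
    (*-monoʳ-∣ r (divides-Δ per t-trib n))
  where
  open ≡-Reasoning
  t : ℤ → ℤ
  t n = _∣_.quotient (r∣s n)
  s≡ : ∀ n → s n ≡ r * t n
  s≡ n = trans (_∣_.equality (r∣s n)) (ℤ.*-comm (t n) r)
  distrib : ∀ r x y → r * (x - y) ≡ r * x - r * y
  distrib = solve-∀
  distrib₃ : ∀ r x y z → r * x + r * y + r * z ≡ r * (x + y + z)
  distrib₃ = solve-∀
  t-trib : Trib t
  t-trib = trib λ n → ℤ.*-cancelˡ-≡ r _ _ (begin
    r * t (n + + 3)                               ≡⟨ s≡ (n + + 3) ⟨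
    s (n + + 3)                                   ≡⟨ recurrence s-trib n ⟩
    s (n + + 2) + s (n + + 1) + s n               ≡⟨ cong₂ _+_ (cong₂ _+_ (s≡ (n + + 2)) (s≡ (n + + 1))) (s≡ n) ⟩
    r * t (n + + 2) + r * t (n + + 1) + r * t n   ≡⟨ distrib₃ r (t (n + + 2)) (t (n + + 1)) (t n) ⟩
    r * (t (n + + 2) + t (n + + 1) + t n)         ∎)

index-suc : ∀ u n M → n + + suc u * M ≡ n + M + + u * M
index-suc u n M = trans (cong (λ x → n + x * M) (ℤ.pos-+ 1 u)) (identity n (+ u) M)
  where
  identity : ∀ n u M → n + (+ 1 + u) * M ≡ n + M + u * M
  identity = solve-∀

index-zero : ∀ n M → n + + 0 * M ≡ n
index-zero = solve-∀

period-multiple : ∀ u → Period M q → Period (+ u * M) q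
period-multiple {M} {q} zero per = period λ {s} s-trib n →
  divides (+ 0) (ℤ.i≡j⇒i-j≡0 (cong s (index-zero n M)))
period-multiple {M} {q} (suc u) per = period λ {s} s-trib n → subst (q ∣_)
  (trans (telescope (s (n + M + + u * M)) (s (n + M)) (s n)) (cong (λ i → s i - s n) (sym (index-suc u n M))))
  (∣m∣n⇒∣m+n (divides-Δ (period-multiple u per) s-trib (n + M)) (divides-Δ per s-trib n))
  where
  telescope : ∀ x y z → (x - y) + (y - z) ≡ x - z
  telescope = solve-∀

period-neg : Period M q → Period (- M) q
period-neg {M} {q} per = period λ {s} s-trib n → subst (q ∣_)
  (trans (cong (λ i → - (s i - s (n - M))) (cancel n M)) (swap (s n) (s (n - M))))
  (∣m⇒∣-m (divides-Δ per s-trib (n - M)))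
  where
  cancel : ∀ n M → n - M + M ≡ n
  cancel = solve-∀
  swap : ∀ x y → - (x - y) ≡ y - x
  swap = solve-∀

period-multipleℤ : ∀ m → Period M q → Period (m * M) q
period-multipleℤ (+ u) per = period-multiple u per
period-multipleℤ {M} {q} -[1+ u ] per =
  subst (λ i → Period i q) (ℤ.neg-distribˡ-* (+ suc u) M) (period-neg (period-multiple (suc u) per))

-- The binomial coefficient u(u - 1)/2, with sum 0 + ... + (u - 1): the coefficient of Δ² in (1 +
-- Δ)ᵘ.
triangle : ℕ → ℕ
triangle zero    = 0
triangle (suc u) = u ℕ.+ triangle u

-- The binomial expansion of E^(uM) = (1 + Δ)^u, truncated after Δ and after Δ².
module _ .{{_ : NonZero q}} (per : Period M q) (s-trib : Trib s) where

  private
    q∣Δ : ∀ n → q ∣ Δ M s n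
    q∣Δ = divides-Δ per s-trib

    q²∣ΔΔ : ∀ n → q * q ∣ Δ M (Δ M s) n
    q²∣ΔΔ = period-scale per (Δ-trib M s-trib) q∣Δ

    q³∣ΔΔΔ : ∀ n → (q * q) * q ∣ Δ M (Δ M (Δ M s)) n
    q³∣ΔΔΔ = period-scale {{ℤ.i*j≢0 q q}} per (Δ-trib M (Δ-trib M s-trib)) q²∣ΔΔ

  expansion₁ : ∀ u n → q * q ∣ s (n + + u * M) - s n - + u * Δ M s n
  expansion₁ zero n = divides (+ 0) (trans (cong (λ i → s i - s n - + 0 * Δ M s n) (index-zero n M)) (identity (s n) (Δ M s n) (q * q)))
    where
    identity : ∀ x y z → x - x - + 0 * y ≡ + 0 * z
    identity = solve-∀
  -- The induction hypothesis is taken at n + M. There the first difference exceeds the one at n by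
  -- the second difference, and u times the latter is a multiple of q².
  expansion₁ (suc u) n = subst (q * q ∣_)
    (trans (combine (s (n + M + + u * M)) (s (n + M + M)) (s (n + M)) (s n) (+ u))
      (cong₂ (λ i v → s i - s n - v * Δ M s n) (sym (index-suc u n M)) (sym (ℤ.pos-+ 1 u))))
    (∣m∣n⇒∣m+n (expansion₁ u (n + M)) (∣n⇒∣m*n (+ u) (q²∣ΔΔ n)))
    where
    combine : ∀ w z y x u → (w - y - u * (z - y)) + u * ((z - y) - (y - x)) ≡ w - x - (+ 1 + u) * (y - x)
    combine = solve-∀

  expansion₂ : ∀ u n → (q * q) * q ∣ s (n + + u * M) - s n - + u * Δ M s n - + triangle u * Δ M (Δ M s) n
  expansion₂ zero n = divides (+ 0) (trans
    (cong (λ i → s i - s n - + 0 * Δ M s n - + 0 * Δ M (Δ M s) n) (index-zero n M))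
    (identity (s n) (Δ M s n) (Δ M (Δ M s) n) ((q * q) * q)))
    where
    identity : ∀ x y z w → x - x - + 0 * y - + 0 * z ≡ + 0 * w
    identity = solve-∀
  -- Now u times the second difference raises `triangle u` to `triangle (suc u)`; the new error is
  -- `triangle u` times the third difference.
  expansion₂ (suc u) n = subst ((q * q) * q ∣_)
    (trans (combine (s (n + M + + u * M)) (s (n + M + M + M)) (s (n + M + M)) (s (n + M)) (s n) (+ u) (+ triangle u))
      (trans (cong₂ (λ i v → s i - s n - v * Δ M s n - (+ u + + triangle u) * Δ M (Δ M s) n) (sym (index-suc u n M)) (sym (ℤ.pos-+ 1 u)))
        (cong (λ v → s (n + + suc u * M) - s n - + suc u * Δ M s n - v * Δ M (Δ M s) n) (sym (ℤ.pos-+ u (triangle u))))))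
    (∣m∣n⇒∣m+n (expansion₂ u (n + M)) (∣n⇒∣m*n (+ triangle u) (q³∣ΔΔΔ n)))
    where
    combine : ∀ v w z y x u t →
      (v - y - u * (z - y) - t * ((w - z) - (z - y))) + t * (((w - z) - (z - y)) - ((z - y) - (y - x)))
      ≡ v - x - (+ 1 + u) * (y - x) - (u + t) * ((z - y) - (y - x))
    combine = solve-∀

∣-* : ∀ {a b c d} → a ∣ b → c ∣ d → a * c ∣ b * d
∣-* {a} {b} {c} {d} a∣b c∣d = ∣-trans (*-monoˡ-∣ c a∣b) (*-monoʳ-∣ b c∣d)

∣-pos : ∀ {m n} → m ℕ.∣ n → + m ∣ + n
∣-pos = ∣ᵤ⇒∣

double-triangle : ∀ u → 2 ℕ.* triangle u ℕ.+ u ≡ u ℕ.* u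
double-triangle zero    = refl
double-triangle (suc u) = trans (expand u (triangle u)) (trans (cong (λ x → x ℕ.+ suc (2 ℕ.* u)) (double-triangle u)) (square u))
  where
  expand : ∀ u t → 2 ℕ.* (u ℕ.+ t) ℕ.+ suc u ≡ (2 ℕ.* t ℕ.+ u) ℕ.+ suc (2 ℕ.* u)
  expand = ℕSolver.solve-∀
  square : ∀ u → u ℕ.* u ℕ.+ suc (2 ℕ.* u) ≡ suc u ℕ.* suc u
  square = ℕSolver.solve-∀

-- Lifting the period to powers of p

module _ {p : ℕ} (p-prime : Prime p) where

  private instance
    _ = prime⇒nonZero p-prime
    _ = prime⇒nonTrivial p-prime

  prime∤ : ∀ {m n} → ¬ p ℕ.∣ m → ¬ p ℕ.∣ n → ¬ p ℕ.∣ m ℕ.* n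
  prime∤ {m} {n} p∤m p∤n p∣mn with euclidsLemma m n p-prime p∣mn
  ... | inj₁ p∣m = p∤m p∣m
  ... | inj₂ p∣n = p∤n p∣n

  prime∣prime⇒≡ : ∀ {q} → Prime q → p ℕ.∣ q → p ≡ q
  prime∣prime⇒≡ q-prime p∣q with prime⇒irreducible q-prime p∣q
  ... | inj₁ refl = contradiction p-prime ¬prime[1]
  ... | inj₂ p≡q = p≡q

  prime-decomposition : ∀ m → m ≢ 0 → ∃[ k ] ∃[ u ] m ≡ p ^ k ℕ.* u × ¬ p ℕ.∣ u
  prime-decomposition = <-rec _ λ m rec m≢0 → decompose m rec m≢0 (p ℕ.∣? m)
    where
    decompose : ∀ m → (∀ {n} → n < m → n ≢ 0 → ∃[ k ] ∃[ u ] n ≡ p ^ k ℕ.* u × ¬ p ℕ.∣ u) →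
                m ≢ 0 → Dec (p ℕ.∣ m) → ∃[ k ] ∃[ u ] m ≡ p ^ k ℕ.* u × ¬ p ℕ.∣ u
    decompose m rec m≢0 (no p∤m) = 0 , m , sym (ℕ.*-identityˡ m) , p∤m
    decompose .(n ℕ.* p) rec m≢0 (yes (ℕ.divides n refl)) =
      let n≢0 = λ n≡0 → m≢0 (cong (ℕ._* p) n≡0)
          k , u , n≡ , p∤u = rec (ℕ.m<m*n n p {{ℕ.≢-nonZero n≢0}} (ℕ.nonTrivial⇒n>1 p)) n≢0
      in suc k , u , trans (cong (ℕ._* p) n≡) (rotate (p ^ k) u p) , p∤u
      where
      rotate : ∀ x u p → x ℕ.* u ℕ.* p ≡ p ℕ.* x ℕ.* u
      rotate = ℕSolver.solve-∀

  ν-decomposed : ∀ z k u → ∣ z ∣ ≡ p ^ k ℕ.* u → ¬ p ℕ.∣ u → ν p z ≡ fin (+ k)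
  ν-decomposed z k u ∣z∣≡ p∤u = ν-unique p z k
    (∣ᵤ⇒∣ (subst (p ^ k ℕ.∣_) (sym ∣z∣≡) (ℕ.m∣m*n u)))
    λ d → p∤u (ℕ.*-cancelˡ-∣ (p ^ k) {{ℕ.m^n≢0 p k}} (subst₂ ℕ._∣_ (ℕ.*-comm p (p ^ k)) ∣z∣≡ (∣⇒∣ᵤ d)))

  pos-^-suc : ∀ k → + (p ^ suc k) ≡ + p * + (p ^ k)
  pos-^-suc k = ℤ.pos-* p (p ^ k)

  module _ (p≢2 : p ≢ 2) where

    -- From 2 `triangle p` + p = p², p divides 2 `triangle p`, and an odd p does not divide 2.
    p∣triangle : p ℕ.∣ triangle p
    p∣triangle with euclidsLemma 2 (triangle p) p-prime (ℕ.∣m+n∣m⇒∣n (subst (p ℕ.∣_) (trans (sym (double-triangle p)) (ℕ.+-comm _ p)) (ℕ.m∣m*n p)) ℕ.∣-refl)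
    ... | inj₁ p∣2 = contradiction (prime∣prime⇒≡ (from-yes (prime? 2)) p∣2) p≢2
    ... | inj₂ p∣t = p∣t

    -- In (1 + Δ)ᵖ the second-order term is divisible by p q², the remainder by q³. Since p ∣ q,
    -- both are multiples of p² q.
    expansion-prime : .{{NonZero q}} → + p ∣ q → Period M q → Trib s → ∀ n →
      + p * (+ p * q) ∣ Δ (+ p * M) s n - + p * Δ M s n
    expansion-prime {q} {M} {s} p∣q per s-trib n = subst (+ p * (+ p * q) ∣_)
      (restore (s (n + + p * M) - s n - + p * Δ M s n) (+ triangle p * Δ M (Δ M s) n))
      (∣m∣n⇒∣m+n
        (∣-trans (∣-* p∣q (*-monoˡ-∣ q p∣q))
          (subst (_∣ _) (ℤ.*-assoc q q q) (expansion₂ per s-trib p n)))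
        (∣-* (∣-pos p∣triangle) (∣-trans (*-monoˡ-∣ q p∣q)
          (period-scale per (Δ-trib M s-trib) (divides-Δ per s-trib) n))))
      where
      restore : ∀ x y → (x - y) + y ≡ x
      restore = solve-∀

    module _ {N : ℤ} (per : Period N (+ p)) where

      -- `expansion-prime` with q = pᵏ⁺¹ has an error divisible by pᵏ⁺³, enough for both halves of
      -- the next stage: the old period and the old approximation are each multiplied by p.
      Δ-power : ∀ k → Period (+ (p ^ k) * N) (+ (p ^ suc k)) ×
        (∀ {s} → Trib s → ∀ n → + (p ^ suc (suc k)) ∣ Δ (+ (p ^ k) * N) s n - + (p ^ k) * Δ N s n)
      Δ-power zero = subst₂ Period (sym (ℤ.*-identityˡ N)) (cong +_ (sym (ℕ.*-identityʳ p))) per ,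
        λ {s} _ n → divides (+ 0) (trans (cong (λ M → Δ M s n - + 1 * Δ N s n) (ℤ.*-identityˡ N)) (vanish (Δ N s n)))
        where
        vanish : ∀ x → x - + 1 * x ≡ + 0
        vanish = solve-∀
      Δ-power (suc k) with Δ-power k
      ... | per-k , approx-k = per-suc , approx-suc
        where
        P Q : ℤ
        P = + (p ^ k)
        Q = + (p ^ suc k)
        index : + p * (P * N) ≡ Q * N
        index = trans (sym (ℤ.*-assoc (+ p) P N)) (cong (_* N) (sym (pos-^-suc k)))
        approx : ∀ {s} → Trib s → ∀ n → + (p ^ suc (suc (suc k))) ∣ Δ (Q * N) s n - + p * Δ (P * N) s n
        approx {s} s-trib n = subst₂ (λ d M → d ∣ Δ M s n - + p * Δ (P * N) s n)
          (trans (cong (+ p *_) (sym (pos-^-suc (suc k)))) (sym (pos-^-suc (suc (suc k))))) index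
          (expansion-prime {{ℕ.m^n≢0 p (suc k)}}
            (∣-pos (ℕ.m∣m*n (p ^ k))) per-k s-trib n)
        restore : ∀ x y → (x - y) + y ≡ x
        restore = solve-∀
        per-suc : Period (Q * N) (+ (p ^ suc (suc k)))
        per-suc = period λ {s} s-trib n → subst (+ (p ^ suc (suc k)) ∣_)
          (restore (Δ (Q * N) s n) (+ p * Δ (P * N) s n))
          (∣m∣n⇒∣m+n (∣-trans (∣-pos (ℕ.n∣m*n p)) (approx s-trib n))
            (subst (_∣ + p * Δ (P * N) s n) (sym (pos-^-suc (suc k))) (*-monoʳ-∣ (+ p) (divides-Δ per-k s-trib n))))
        approx-suc : ∀ {s} → Trib s → ∀ n → + (p ^ suc (suc (suc k))) ∣ Δ (Q * N) s n - Q * Δ N s n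
        approx-suc {s} s-trib n = subst (+ (p ^ suc (suc (suc k))) ∣_)
          (trans (combine (Δ (Q * N) s n) (+ p) (Δ (P * N) s n) P (Δ N s n))
            (cong (λ x → Δ (Q * N) s n - x * Δ N s n) (sym (pos-^-suc k))))
          (∣m∣n⇒∣m+n (approx s-trib n)
            (subst (_∣ + p * (Δ (P * N) s n - P * Δ N s n)) (sym (pos-^-suc (suc (suc k)))) (*-monoʳ-∣ (+ p) (approx-k s-trib n))))
          where
          combine : ∀ x p y P z → (x - p * y) + p * (y - P * z) ≡ x - (p * P) * z
          combine = solve-∀

      -- For the remaining factor u first order is enough: the error of `expansion₁` is a multiple
      -- of p²ᵏ⁺², hence of pᵏ⁺².
      Δ-multiple : ∀ k u → Trib s → ∀ n →
        + (p ^ suc (suc k)) ∣ Δ (+ (p ^ k ℕ.* u) * N) s n - + (p ^ k ℕ.* u) * Δ N s n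
      Δ-multiple {s} k u s-trib n with Δ-power k
      ... | per-k , approx-k = subst (+ (p ^ suc (suc k)) ∣_)
        (trans (combine (Δ (+ u * (P * N)) s n) (+ u) (Δ (P * N) s n) P (Δ N s n))
          (cong₂ (λ M x → Δ M s n - x * Δ N s n)
            (trans (regroup (+ u) P N) (cong (_* N) (sym (ℤ.pos-* (p ^ k) u)))) (sym (ℤ.pos-* (p ^ k) u))))
        (∣m∣n⇒∣m+n
          (∣-trans (subst (_∣ Q * Q) (sym (pos-^-suc (suc k))) (*-monoˡ-∣ Q (∣-pos {p} (ℕ.m∣m*n (p ^ k)))))
            (expansion₁ {{ℕ.m^n≢0 p (suc k)}} per-k s-trib u n))
          (∣n⇒∣m*n (+ u) (approx-k s-trib n)))
        where
        P Q : ℤ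
        P = + (p ^ k)
        Q = + (p ^ suc k)
        combine : ∀ x u y P z → (x - u * y) + u * (y - P * z) ≡ x - (P * u) * z
        combine = solve-∀
        regroup : ∀ u P N → u * (P * N) ≡ (P * u) * N
        regroup = solve-∀

      -- The difference is p times a Tribonacci sequence, which has period j N modulo p. Thus
      -- divisibility of `Δ N s n` by p² depends only on the class of n modulo N.
      Δ-shift : Trib s → ∀ n j → + (p ^ 2) ∣ Δ N s (n + j * N) - Δ N s n
      Δ-shift {s} s-trib n j = subst (_∣ _)
        (trans (sym (ℤ.pos-* p p)) (cong (λ x → + (p ℕ.* x)) (sym (ℕ.*-identityʳ p))))
        (period-scale (period-multipleℤ j per) (Δ-trib N s-trib) (divides-Δ per s-trib) n)

-- Periods modulo p from power sums

-- Half the adjugate, up to sign, of the Hankel matrix (S (i + j)) for i, j < 3,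
-- whose determinant is -44.
c₀ c₁ c₂ : (ℤ → ℤ) → ℤ → ℤ
c₀ s n = + 8 * s n - + 5 * s (n + + 1) + s (n + + 2)
c₁ s n = - + 5 * s n - + 12 * s (n + + 1) + + 9 * s (n + + 2)
c₂ s n = s n + + 9 * s (n + + 1) - + 4 * s (n + + 2)

-- Both sides obey the recurrence in m, and for m = 0, 1, 2 the claim is the Hankel matrix times its
-- halved adjugate. With n any integer, negative indices are covered although `S` lives on ℕ.
power-sum-expansion : Trib s → ∀ n m → + 22 * s (n + + m) ≡ c₀ s n * S m + c₁ s n * S (1 ℕ.+ m) + c₂ s n * S (2 ℕ.+ m)
power-sum-expansion {s} s-trib n 0 = trans (cong (λ i → + 22 * s i) (ℤ.+-identityʳ n)) (identity (s n) (s (n + + 1)) (s (n + + 2)))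
  where
  identity : ∀ x y z → + 22 * x ≡ (+ 8 * x - + 5 * y + z) * + 3 + (- + 5 * x - + 12 * y + + 9 * z) * + 1 + (x + + 9 * y - + 4 * z) * + 3
  identity = solve-∀
power-sum-expansion {s} s-trib n 1 = identity (s n) (s (n + + 1)) (s (n + + 2))
  where
  identity : ∀ x y z → + 22 * y ≡ (+ 8 * x - + 5 * y + z) * + 1 + (- + 5 * x - + 12 * y + + 9 * z) * + 3 + (x + + 9 * y - + 4 * z) * + 7
  identity = solve-∀
power-sum-expansion {s} s-trib n 2 = identity (s n) (s (n + + 1)) (s (n + + 2))
  where
  identity : ∀ x y z → + 22 * z ≡ (+ 8 * x - + 5 * y + z) * + 3 + (- + 5 * x - + 12 * y + + 9 * z) * + 7 + (x + + 9 * y - + 4 * z) * + 11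
  identity = solve-∀
power-sum-expansion {s} s-trib n (suc (suc (suc m))) = begin
  + 22 * s (n + + (3 ℕ.+ m))
    ≡⟨ cong (+ 22 *_) (trans (cong s (index 3)) (trans (recurrence s-trib (n + + m))
         (cong₂ (λ x y → s x + s y + s (n + + m)) (sym (index 2)) (sym (index 1))))) ⟩
  + 22 * (s (n + + (2 ℕ.+ m)) + s (n + + (1 ℕ.+ m)) + s (n + + m))
    ≡⟨ distrib (s (n + + (2 ℕ.+ m))) (s (n + + (1 ℕ.+ m))) (s (n + + m)) ⟩
  + 22 * s (n + + (2 ℕ.+ m)) + + 22 * s (n + + (1 ℕ.+ m)) + + 22 * s (n + + m)
    ≡⟨ cong₂ _+_ (cong₂ _+_ (power-sum-expansion s-trib n (suc (suc m))) (power-sum-expansion s-trib n (suc m))) (power-sum-expansion s-trib n m) ⟩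
  _ ≡⟨ collect (c₀ s n) (c₁ s n) (c₂ s n) (S m) (S (1 ℕ.+ m)) (S (2 ℕ.+ m)) ⟩
  c₀ s n * S (3 ℕ.+ m) + c₁ s n * S (4 ℕ.+ m) + c₂ s n * S (5 ℕ.+ m)   ∎
  where
  open ≡-Reasoning
  index : ∀ k → n + + (k ℕ.+ m) ≡ n + + m + + k
  index k = trans (cong (λ j → n + j) (trans (ℤ.pos-+ k m) (ℤ.+-comm (+ k) (+ m)))) (sym (ℤ.+-assoc n (+ m) (+ k)))
  distrib : ∀ x y z → + 22 * (x + y + z) ≡ + 22 * x + + 22 * y + + 22 * z
  distrib = solve-∀
  collect : ∀ a b c x y z →
    (a * z + b * (z + y + x) + c * ((z + y + x) + z + y)) + (a * y + b * z + c * (z + y + x)) + (a * x + b * y + c * z)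
    ≡ a * (z + y + x) + b * ((z + y + x) + z + y) + c * (((z + y + x) + z + y) + (z + y + x) + z)
  collect = solve-∀

module _ {p : ℕ} (p-prime : Prime p) where

  prime∤22 : p ≢ 2 → p ≢ 11 → ¬ p ℕ.∣ 22
  prime∤22 p≢2 p≢11 = prime∤ p-prime {2} {11}
    (p≢2 ∘ prime∣prime⇒≡ p-prime (from-yes (prime? 2))) (p≢11 ∘ prime∣prime⇒≡ p-prime (from-yes (prime? 11)))

  period-from-power-sums : p ≢ 2 → p ≢ 11 → ∀ N → (∀ k → + p ∣ S (k ℕ.+ N) - S k) → Period (+ N) (+ p)
  period-from-power-sums p≢2 p≢11 N p∣ΔS = period λ {s} s-trib n → cancel-22 (subst (+ p ∣_)
    (trans (regroup (c₀ s n) (c₁ s n) (c₂ s n) (S N) (S (1 ℕ.+ N)) (S (2 ℕ.+ N)) (S 0) (S 1) (S 2))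
      (trans (cong₂ _-_ (sym (power-sum-expansion s-trib n N))
          (trans (sym (power-sum-expansion s-trib n 0)) (cong (λ i → + 22 * s i) (ℤ.+-identityʳ n))))
        (distrib (s (n + + N)) (s n))))
    (∣m∣n⇒∣m+n (∣m∣n⇒∣m+n (∣n⇒∣m*n (c₀ s n) (p∣ΔS 0)) (∣n⇒∣m*n (c₁ s n) (p∣ΔS 1))) (∣n⇒∣m*n (c₂ s n) (p∣ΔS 2))))
    where
    regroup : ∀ a b c x y z x′ y′ z′ → a * (x - x′) + b * (y - y′) + c * (z - z′)
      ≡ (a * x + b * y + c * z) - (a * x′ + b * y′ + c * z′)
    regroup = solve-∀
    distrib : ∀ x y → + 22 * x - + 22 * y ≡ + 22 * (x - y)
    distrib = solve-∀
    cancel-22 : ∀ {x} → + p ∣ + 22 * x → + p ∣ x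
    cancel-22 {x} d with euclidsLemma 22 ∣ x ∣ p-prime (subst (p ℕ.∣_) (ℤ.abs-* (+ 22) x) (∣⇒∣ᵤ d))
    ... | inj₁ p∣22 = contradiction p∣22 (prime∤22 p≢2 p≢11)
    ... | inj₂ p∣x = ∣ᵤ⇒∣ p∣x

-- Valuations

T-trib : Trib T
T-trib = trib T-rec

module _ {p : ℕ} (p-prime : Prime p) where

  private instance
    _ = prime⇒nonZero p-prime
    _ = prime⇒nonTrivial p-prime

  -- `D` has valuation exactly 1, so the main term has valuation k + 1, out of reach of an error
  -- divisible by pᵏ⁺².
  ν-approximation : ∀ {x D} k u → ¬ p ℕ.∣ u → + p ∣ D → ¬ + (p ^ 2) ∣ D →
    + (p ^ suc (suc k)) ∣ x - + (p ^ k ℕ.* u) * D → ν p x ≡ fin (+ suc k)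
  ν-approximation {x} {D} k u p∤u p∣D p²∤D approx with ∣⇒∣ᵤ p∣D
  ... | ℕ.divides d ∣D∣≡ = ν-unique p x (suc k) lower upper
    where
    U : ℤ
    U = + (p ^ k ℕ.* u)
    add-back : ∀ x y → (x - y) + y ≡ x
    add-back = solve-∀
    subtract : ∀ x y → x - (x - y) ≡ y
    subtract = solve-∀
    lower : + (p ^ suc k) ∣ x
    lower = subst (+ (p ^ suc k) ∣_) (add-back x (U * D)) (∣m∣n⇒∣m+n
      (∣-trans (∣-pos {p ^ suc k} (ℕ.n∣m*n p)) approx)
      (subst (_∣ U * D) (trans (ℤ.*-comm (+ (p ^ k)) (+ p)) (sym (pos-^-suc p-prime k)))
        (∣-* (∣-pos {p ^ k} (ℕ.m∣m*n u)) p∣D)))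
    p∤d : ¬ p ℕ.∣ d
    p∤d p∣d = p²∤D (∣ᵤ⇒∣ (subst₂ ℕ._∣_ (cong (p ℕ.*_) (sym (ℕ.*-identityʳ p))) (sym ∣D∣≡) (ℕ.*-monoˡ-∣ p p∣d)))
    regroup : ∀ q u d p → q ℕ.* u ℕ.* (d ℕ.* p) ≡ (p ℕ.* q) ℕ.* (u ℕ.* d)
    regroup = ℕSolver.solve-∀
    upper : ¬ + (p ^ suc (suc k)) ∣ x
    upper d∣x = prime∤ p-prime p∤u p∤d (ℕ.*-cancelˡ-∣ (p ^ suc k) {{ℕ.m^n≢0 p (suc k)}}
      (subst₂ ℕ._∣_ (ℕ.*-comm p (p ^ suc k))
        (trans (ℤ.abs-* U D) (trans (cong (p ^ k ℕ.* u ℕ.*_) ∣D∣≡) (regroup (p ^ k) u d p)))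
        (∣⇒∣ᵤ (subst (+ (p ^ suc (suc k)) ∣_) (subtract x (U * D)) (∣m∣n⇒∣m-n d∣x approx)))))

  module _ (p≢2 : p ≢ 2) {N : ℤ} (per : Period N (+ p)) where

    -- For m = ± pᵏu, the term T (a + m N) is ± pᵏ u Δ N T up to a multiple of pᵏ⁺².
    ν-near-zero : ∀ {a} → T a ≡ + 0 → (∀ j → ¬ + (p ^ 2) ∣ Δ N T (a + j * N)) →
      ∀ m k u → ∣ m ∣ ≡ p ^ k ℕ.* u → ¬ p ℕ.∣ u → ν p (T (a + m * N)) ≡ fin (+ suc k)
    ν-near-zero {a} Ta≡0 p²∤Δ (+ v) k u refl p∤u =
      ν-approximation {T (a + + (p ^ k ℕ.* u) * N)} {Δ N T a} k u p∤u (divides-Δ per T-trib a)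
        (subst (λ i → ¬ + (p ^ 2) ∣ Δ N T i) (index-zero a N) (p²∤Δ (+ 0)))
        (subst (λ y → + (p ^ suc (suc k)) ∣ y - + (p ^ k ℕ.* u) * Δ N T a)
          (trans (cong (λ y → T (a + + (p ^ k ℕ.* u) * N) - y) Ta≡0) (ℤ.+-identityʳ (T (a + + (p ^ k ℕ.* u) * N))))
          (Δ-multiple p-prime p≢2 per k u T-trib a))
    -- Expansions only run upwards, so this one starts at n = a + m N and reaches the zero a after
    -- |m| steps. The relevant difference then sits at n, which is why `p²∤Δ` speaks of the whole
    -- orbit of a.
    ν-near-zero {a} Ta≡0 p²∤Δ -[1+ v ] k u ∣m∣≡ p∤u =
      ν-approximation {T n} { - Δ N T n} k u p∤u (∣m⇒∣-m (divides-Δ per T-trib n))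
        (λ d → p²∤Δ -[1+ v ] (subst (+ (p ^ 2) ∣_) (ℤ.neg-involutive (Δ N T n)) (∣m⇒∣-m d)))
        (subst (+ (p ^ suc (suc k)) ∣_)
          (trans (cong (λ y → - (y - T n - U * Δ N T n)) (trans (cong T return) Ta≡0)) (negate (T n) U (Δ N T n)))
          (∣m⇒∣-m (Δ-multiple p-prime p≢2 per k u T-trib n)))
      where
      n U : ℤ
      n = a + -[1+ v ] * N
      U = + (p ^ k ℕ.* u)
      return : n + U * N ≡ a
      return = trans (cong (λ w → a + -[1+ v ] * N + + w * N) (sym ∣m∣≡)) (cancel a (+ suc v) N)
        where
        cancel : ∀ a v N → a + (- v) * N + v * N ≡ a
        cancel = solve-∀
      negate : ∀ x u d → - (+ 0 - x - u * d) ≡ x - u * (- d)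
      negate = solve-∀

  module _ (p≢2 : p ≢ 2) {N : ℕ} (0<N : 0 < N) (per : Period (+ N) (+ p)) where

    eventually-constant : ∀ i → ¬ + p ∣ T (+ i) → EventuallyConstant p N i
    eventually-constant i p∤Ti = 0 , [] , λ n n≡i _ →
      ν-unique p (T n) 0 (divides (T n) (sym (ℤ.*-identityʳ (T n)))) λ p∣Tn →
        p∤Ti (subst (+ p ∣_) (subtract (T n) (T (+ i))) (∣m∣n⇒∣m-n
          (subst (λ x → + x ∣ T n) (ℕ.*-identityʳ p) p∣Tn) (p∣ΔT n n≡i)))
      where
      subtract : ∀ x y → x - (x - y) ≡ y
      subtract = solve-∀
      add-back : ∀ x y → y + (x - y) ≡ x
      add-back = solve-∀
      p∣ΔT : ∀ n → n ≡ + i [mod N ] → + p ∣ T n - T (+ i)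
      p∣ΔT n (divides j n-i≡) = subst (λ m → + p ∣ T m - T (+ i))
        (trans (cong (λ x → + i + x) (sym n-i≡)) (add-back n (+ i)))
        (divides-Δ (period-multipleℤ j per) T-trib (+ i))

    eventually-linear : ∀ {i a} → T a ≡ + 0 → + i ≡ a [mod N ] →
      ¬ (T (+ i + + N) ≡ T (+ i) [mod p ^ 2 ]) → EventuallyLinear p N i
    eventually-linear {i} {a} Ta≡0 (divides q i-a≡) p²∤ =
      -- With e = ν N and n = a + m N, the value 1 + ν m equals (1 - e) + ν (n - a).
      a , + 1 - + e , + 1 , ℤ.+<+ (ℕ.s≤s ℕ.z≤n) , ν-N≤ , [] , λ n n≡i _ → linear n n≡i
      where
      N≢0 : N ≢ 0
      N≢0 refl = ℕ.<-irrefl refl 0<N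
      N-decomposition : ∃[ k ] ∃[ u ] N ≡ p ^ k ℕ.* u × ¬ p ℕ.∣ u
      N-decomposition = prime-decomposition p-prime N N≢0
      e N′ : ℕ
      e = proj₁ N-decomposition
      N′ = proj₁ (proj₂ N-decomposition)
      N≡ : N ≡ p ^ e ℕ.* N′
      N≡ = proj₁ (proj₂ (proj₂ N-decomposition))
      p∤N′ : ¬ p ℕ.∣ N′
      p∤N′ = proj₂ (proj₂ (proj₂ N-decomposition))

      regroup : ∀ x u y v → (x ℕ.* u) ℕ.* (y ℕ.* v) ≡ (y ℕ.* x) ℕ.* (v ℕ.* u)
      regroup = ℕSolver.solve-∀
      ν-multiple : ∀ m k u → ∣ m ∣ ≡ p ^ k ℕ.* u → ¬ p ℕ.∣ u → ν p (m * + N) ≡ fin (+ (e ℕ.+ k))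
      ν-multiple m k u m≡ p∤u = ν-decomposed p-prime (m * + N) (e ℕ.+ k) (N′ ℕ.* u)
        (trans (ℤ.abs-* m (+ N)) (trans (cong₂ ℕ._*_ m≡ N≡) (trans (regroup (p ^ k) u (p ^ e) N′)
          (cong (ℕ._* (N′ ℕ.* u)) (sym (ℕ.^-distribˡ-+-* p e k))))))
        (prime∤ p-prime p∤N′ p∤u)

      ν-N≤-multiple : ∀ m → ν p (+ N) ≤⁺ ν p (m * + N)
      ν-N≤-multiple m with ∣ m ∣ ℕ.≟ 0
      ... | yes m≡0 = subst (λ m → ν p (+ N) ≤⁺ ν p (m * + N)) (sym (ℤ.∣i∣≡0⇒i≡0 {m} m≡0)) (_ ≤⊤⁺)
      ... | no m≢0 with prime-decomposition p-prime ∣ m ∣ m≢0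
      ... | k , u , m≡ , p∤u =
        subst₂ _≤⁺_ (sym (ν-decomposed p-prime (+ N) e N′ N≡ p∤N′)) (sym (ν-multiple m k u m≡ p∤u))
          (fin≤ (ℤ.+≤+ (ℕ.m≤m+n e k)))

      ν-N≤ : ν p (+ N) ≤⁺ ν p (a - + i)
      ν-N≤ = subst (λ x → ν p (+ N) ≤⁺ ν p x)
        (trans (sym (ℤ.neg-distribˡ-* q (+ N))) (trans (cong -_ (sym i-a≡)) (swap (+ i) a)))
        (ν-N≤-multiple (- q))
        where
        swap : ∀ x y → - (x - y) ≡ y - x
        swap = solve-∀

      -- The assumption concerns the index i, whereas expansions start at translates of a; `Δ-shift`
      -- carries it over, using a + j N = i + (j - q) N.
      p²∤Δ : ∀ j → ¬ + (p ^ 2) ∣ Δ (+ N) T (a + j * + N)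
      p²∤Δ j d = p²∤ (subst (+ (p ^ 2) ∣_) (subtract (Δ (+ N) T (a + j * + N)) (Δ (+ N) T (+ i)))
        (∣m∣n⇒∣m-n d (subst (λ n → + (p ^ 2) ∣ Δ (+ N) T n - Δ (+ N) T (+ i)) shift
          (Δ-shift p-prime p≢2 per T-trib (+ i) (j - q)))))
        where
        subtract : ∀ x y → x - (x - y) ≡ y
        subtract = solve-∀
        identity : ∀ i a j q N → i + (j - q) * N ≡ a + j * N + ((i - a) - q * N)
        identity = solve-∀
        vanish : ∀ x y → x + (y - y) ≡ x
        vanish = solve-∀
        shift : + i + (j - q) * + N ≡ a + j * + N
        shift = trans (identity (+ i) a j q (+ N))
          (trans (cong (λ x → a + j * + N + (x - q * + N)) i-a≡) (vanish (a + j * + N) (q * + N)))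

      linear-orbit : ∀ m → ν p (T (a + m * + N)) ≡ affine (+ 1 - + e) (+ 1) (ν p (m * + N))
      linear-orbit m with ∣ m ∣ ℕ.≟ 0
      -- At n = a both valuations are ∞, which `affine` preserves; the zero itself therefore needs
      -- no exception.
      ... | yes m≡0 = subst (λ m → ν p (T (a + m * + N)) ≡ affine (+ 1 - + e) (+ 1) (ν p (m * + N)))
        (sym (ℤ.∣i∣≡0⇒i≡0 {m} m≡0)) (cong (ν p) (trans (cong T (index-zero a (+ N))) Ta≡0))
      ... | no m≢0 with prime-decomposition p-prime ∣ m ∣ m≢0
      ... | k , u , m≡ , p∤u = trans (ν-near-zero p≢2 per {a} Ta≡0 p²∤Δ m k u m≡ p∤u)
        (trans (cong fin (trans (ℤ.pos-+ 1 k)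
            (trans (offset (+ e) (+ k)) (cong (λ x → + 1 - + e + + 1 * x) (sym (ℤ.pos-+ e k))))))
          (cong (affine (+ 1 - + e) (+ 1)) (sym (ν-multiple m k u m≡ p∤u))))
        where
        offset : ∀ e k → + 1 + k ≡ + 1 - e + + 1 * (e + k)
        offset = solve-∀

      linear : ∀ n → n ≡ + i [mod N ] → ν p (T n) ≡ affine (+ 1 - + e) (+ 1) (ν p (n - a))
      linear n (divides j n-i≡) = subst₂ (λ x y → ν p (T x) ≡ affine (+ 1 - + e) (+ 1) (ν p y))
        (trans (cong (λ x → a + x) n-a≡) (add-back n a)) n-a≡ (linear-orbit (j + q))
        where
        add-back : ∀ x y → y + (x - y) ≡ x
        add-back = solve-∀
        telescope : ∀ x y z → (x - y) + (y - z) ≡ x - z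
        telescope = solve-∀
        n-a≡ : (j + q) * + N ≡ n - a
        n-a≡ = trans (ℤ.*-distribʳ-+ (+ N) j q) (trans (cong₂ _+_ (sym n-i≡) (sym i-a≡)) (telescope n (+ i) a))

-- The two cases of the law, with Q = N

T-zero : ∀ {a} → a ∈ (+ 0 ∷ - + 1 ∷ - + 4 ∷ - + 17 ∷ []) → T a ≡ + 0
T-zero (here refl)                         = refl
T-zero (there (here refl))                 = refl
T-zero (there (there (here refl)))         = refl
T-zero (there (there (there (here refl)))) = refl

nonempty : ∀ {n} → Fin n → 0 < n
nonempty {suc n} _ = s≤s z≤n

multiplicity-law : ∀ {p} (p-prime : Prime p) → p ≢ 2 → ∀ {N} → 0 < N → Period (+ N) (+ p) →
  (∀ ℓ → ℓ < N → + p ∣ T (+ ℓ) →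
    ¬ (T (+ ℓ + + N) ≡ T (+ ℓ) [mod p ^ 2 ]) ×
    (∃[ a ] a ∈ (+ 0 ∷ - + 1 ∷ - + 4 ∷ - + 17 ∷ []) × + ℓ ≡ a [mod N ])) →
  ML p
multiplicity-law {p} p-prime p≢2 {N} 0<N per zeros = N , 0<N , λ i i<N → classify i i<N (+ p ∣? T (+ i))
  where
  classify : ∀ i → i < N → Dec (+ p ∣ T (+ i)) → EventuallyConstant p N i ⊎ EventuallyLinear p N i
  classify i i<N (no p∤Ti) = inj₁ (eventually-constant p-prime p≢2 0<N per i p∤Ti)
  classify i i<N (yes p∣Ti) with zeros i i<N p∣Ti
  -- The index i is only a zero modulo p; the expansion is centred at the exact zero a in its class.
  ... | p²∤ , a , a∈ , i≡a = inj₂ (eventually-linear p-prime p≢2 0<N per {a = a} (T-zero a∈) i≡a p²∤)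

theorem23 : ∀ {c ℓ₁ ℓ₂} (p : ℕ) (p-prime : Prime p) → p ≢ 2 → p ≢ 11 →
    (F : TribonacciField p p-prime c ℓ₁ ℓ₂) (N : ℕ) → HasOrder (rootGroup p p-prime F) N →
    (∀ (ℓ : ℕ) → ℓ < N → + p ∣ T (+ ℓ) →
    ¬ (T (+ ℓ + + N) ≡ T (+ ℓ) [mod p ^ 2 ]) ×
    (∃[ a ] a ∈ (+ 0 ∷ - + 1 ∷ - + 4 ∷ - + 17 ∷ []) × (+ ℓ) ≡ a [mod N ])) →
    ML p
theorem23 p p-prime p≢2 p≢11 F N order = multiplicity-law p-prime p≢2
  -- The identity of the group occupies a place in `Fin N`, so the modulus N is positive.
  (nonempty (Inverse.from order (Group.ε (rootGroup p p-prime F))))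
  (period-from-power-sums p-prime p≢2 p≢11 N (power-sum-period p p-prime F order))
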